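{- For every $m,n,\lambda\in\mathbb{N}$ and each $\mu\in\{0,\dots,\lambda\}$: if $m\ne n$, then $$OP_{K_{m,n},\operatorname{Aut}(K_{m,n})}(\lambda,\mu)=\frac{1}{m!\,n!}\sum_{k=0}^{m}\sum_{l=0}^{n}\left[{m\atop k}\right]\left[{n\atop l}\right]P_{K_{k,l}}(\lambda,\mu);$$ and $$OP_{K_{n,n},\operatorname{Aut}(K_{n,n})}(\lambda,\mu)=\frac{1}{2\cdot n!\cdot n!}\sum_{k,l=0}^{n}\left[{n\atop k}\right]\left[{n\atop l}\right]P_{K_{k,l}}(\lambda,\mu)+\frac12\binom{n+\lambda-\mu-1}{n},$$ where $P_{K_{k,l}}(\lambda,\mu)$ is given by $$P_{K_{k,l}}(\lambda,\mu)=\sum_{i=0}^{k}\binom{k}{i}(\lambda-\mu)^{k-i}\sum_{j=0}^{i}\left\{{i\atop j}\right\}(\lambda-j)^{l}\,\mu^{\underline{j}}.$$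
   Context: $\mathbb{N}$ denotes the positive integers. $K_{m,n}$ is the complete bipartite graph on $m+n$ vertices with parts of sizes $m$ and $n$. $\operatorname{Aut}(\Gamma)$ is the automorphism group of a graph $\Gamma$, viewed as a group of permutations of the vertices. A $\lambda$-coloring of $\Gamma$ is a map $f$ from the vertex set of $\Gamma$ to $\{1,\dots,\lambda\}$; it is $\mu$-proper if for every pair of adjacent vertices $v,w$, either $f(v)\ne f(w)$ or $f(v)=f(w)>\mu$. $P_\Gamma(\lambda,\mu)$ is the number of $\mu$-proper $\lambda$-colorings of $\Gamma$. For a subgroup $G$ of $\operatorname{Aut}(\Gamma)$, $OP_{\Gamma,G}(\lambda,\mu)$ is the number of equivalence classes of $\mu$-proper $\lambda$-colorings of $\Gamma$, where $f$ and $f'$ are equivalent if $f'=f\circ g$ for some $g\in G$. $\left[{n\atop k}\right]$ denotes the unsigned Stirling numbers of the first kind (number of permutations of $n$ elements with exactly $k$ cycles), $\left\{{i\atop j}\right\}$ the Stirling numbers of the second kind, and $x^{\underline{k}}=x(x-1)\cdots(x-k+1)$ the falling factorial. Convention: $0^0=1$. -}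

module Defs where

open import Data.Bool.Base using (Bool; true; false)
import Data.Bool.Properties as Bool
open import Data.Fin.Base using (Fin; zero; toℕ; splitAt; finToFun)
open import Data.Fin.Permutation as Perm
  using (Permutation′; _⟨$⟩ʳ_; _≈_; _∘ₚ_; flip; lift₀; remove; transpose; inverseˡ; inverseʳ)
import Data.Fin.Permutation.Components as PC
open import Data.Fin.Properties using (_≟_; any?; all?)
open import Data.Integer.Base using (+_)
open import Data.List.Base
  using (List; []; _∷_; map; filter; length; deduplicate; allFin; applyUpTo; cartesianProductWith)
open import Data.List.Membership.Propositional using (_∈_; lose; find)
open import Data.List.Membership.Propositional.Properties
  using (∈-allFin; ∈-cartesianProductWith⁺)
open import Data.List.Relation.Unary.Any as Any using (here)
open import Data.Nat.Base using (ℕ; zero; suc; _+_; _*_; _∸_; _^_; _<_)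
open import Data.Nat.Combinatorics using (_C_; _P_)
open import Data.Nat.GeneralisedArithmetic using (iterate)
open import Data.Nat.ListAction using (sum)
import Data.Nat.Properties as ℕ
open import Data.Product.Base using (_×_; _,_; ∃; ∃-syntax)
open import Data.Rational.Base using (ℚ)
open import Data.Rational.Literals using (fromℤ)
open import Data.Sum.Base using (_⊎_; [_,_]′)
open import Function.Base using (const; _∘_)
open import Function.Bundles using (_⇔_; mk⇔; Equivalence)
open import Function.Definitions using (StrictlySurjective)
open import Level using (0ℓ)
open import Relation.Binary.Core using (Rel)
open import Relation.Binary.Definitions using () renaming (Decidable to Decidable₂)
open import Relation.Binary.PropositionalEquality
  using (_≡_; _≢_; refl; sym; trans; cong; subst₂; ≢-sym)
open import Relation.Nullary using (¬_; Dec)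
open import Relation.Nullary.Decidable using (¬?; map′; dec-true; _×-dec_; _⊎-dec_; _→-dec_)
open import Relation.Unary using (Pred; Decidable)

private
  variable
    k n : ℕ

------------------------------------------------------------------------
-- Finite counting

∑≤ : ℕ → (ℕ → ℕ) → ℕ
∑≤ n f = sum (applyUpTo f (suc n))

syntax ∑≤ n (λ k → e) = ∑[ k ≤ n ] e
infix 5 ∑≤

fromℕ : ℕ → ℚ
fromℕ k = fromℤ (+ k)

-- If R is an equivalence relation, the number of its classes meeting xs.

#classes : {A : Set} {R : Rel A 0ℓ} → Decidable₂ R → List A → ℕ
#classes R? xs = length (deduplicate R? xs)

-- finToFun is one half of the bijection between Fin (k ^ n) and Fin n → Fin k.

functions : ∀ n k → List (Fin n → Fin k)
functions n k = map finToFun (allFin (k ^ n))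

-- Every permutation σ of Fin (suc n) is obtained exactly once, namely with
-- j = σ 0 and with π given by (0 j) ∘ σ, which fixes 0.

permutations : ∀ n → List (Permutation′ n)
permutations zero    = Perm.id ∷ []
permutations (suc n) =
  cartesianProductWith (λ j π → lift₀ π ∘ₚ transpose zero j) (allFin (suc n)) (permutations n)

permutations-complete : (σ : Permutation′ n) → ∃[ π ] π ∈ permutations n × π ≈ σ
permutations-complete {zero}  σ = Perm.id , here refl , λ ()
permutations-complete {suc n} σ =
  let π , π∈ , π≈ = permutations-complete (remove zero τ)
  in  lift₀ π ∘ₚ transpose zero j ,
      ∈-cartesianProductWith⁺ _ (∈-allFin j) π∈ ,
      λ i → trans (cong (PC.transpose zero j)
                    (trans (Perm.lift₀-cong π (remove zero τ) π≈ i)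
                           (Perm.lift₀-remove τ τ-fixes-zero i)))
                  (PC.transpose-inverse zero j)
  where
  j : Fin (suc n)
  j = σ ⟨$⟩ʳ zero
  τ : Permutation′ (suc n)
  τ = σ ∘ₚ transpose j zero
  τ-fixes-zero : τ ⟨$⟩ʳ zero ≡ zero
  τ-fixes-zero rewrite dec-true (j ≟ j) refl = refl

∃-permutation? : {Q : Pred (Permutation′ n) 0ℓ} → Decidable Q →
                 (∀ {π ρ} → π ≈ ρ → Q π → Q ρ) → Dec (∃ Q)
∃-permutation? {n} {Q} Q? resp = map′ to from (Any.any? Q? (permutations n))
  where
  to : Any.Any Q (permutations n) → ∃ Q
  to p = let π , _ , q = find p in π , q
  from : ∃ Q → Any.Any Q (permutations n)
  from (σ , q) = let π , π∈ , π≈σ = permutations-complete σ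
                 in lose π∈ (resp (λ i → sym (π≈σ i)) q)

------------------------------------------------------------------------
-- Stirling numbers

-- The cycle of i in a permutation of an n-element set has at most n elements,
-- so exponents below n suffice.

SameCycle : Permutation′ n → Rel (Fin n) 0ℓ
SameCycle {n} π i j = ∃[ e ] iterate (π ⟨$⟩ʳ_) i (toℕ {n} e) ≡ j

sameCycle? : (π : Permutation′ n) → Decidable₂ (SameCycle π)
sameCycle? π i j = any? λ e → iterate (π ⟨$⟩ʳ_) i (toℕ e) ≟ j

#cycles : Permutation′ n → ℕ
#cycles {n} π = #classes (sameCycle? π) (allFin n)

stirling₁ : ℕ → ℕ → ℕ
stirling₁ n k = length (filter (λ π → #cycles π ℕ.≟ k) (permutations n))

-- A partition of Fin n into k nonempty blocks is a surjection Fin n → Fin k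
-- up to relabelling of the blocks, that is, up to having the same kernel.

surjective? : Decidable {A = Fin n → Fin k} (StrictlySurjective _≡_)
surjective? f = all? λ y → any? λ x → f x ≟ y

SameKernel : Rel (Fin n → Fin k) 0ℓ
SameKernel f g = ∀ x y → (f x ≡ f y → g x ≡ g y) × (g x ≡ g y → f x ≡ f y)

sameKernel? : Decidable₂ (SameKernel {n} {k})
sameKernel? f g = all? λ x → all? λ y →
  (f x ≟ f y →-dec g x ≟ g y) ×-dec (g x ≟ g y →-dec f x ≟ f y)

stirling₂ : ℕ → ℕ → ℕ
stirling₂ n k = #classes sameKernel? (filter surjective? (functions n k))

------------------------------------------------------------------------
-- Graphs and their automorphisms

record Graph : Set₁ where
  field
    order       : ℕ
    Adj         : Rel (Fin order) 0ℓ
    adj?        : Decidable₂ Adj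
    symmetric   : ∀ {v w} → Adj v w → Adj w v
    irreflexive : ∀ {v} → ¬ Adj v v

  Vertex : Set
  Vertex = Fin order

K : ℕ → ℕ → Graph
K m n = record
  { order       = m + n
  ; Adj         = λ v w → part v ≢ part w
  ; adj?        = λ v w → ¬? (part v Bool.≟ part w)
  ; symmetric   = ≢-sym
  ; irreflexive = λ p → p refl
  }
  where
  part : Fin (m + n) → Bool
  part v = [ const false , const true ]′ (splitAt m v)

module _ (Γ : Graph) where
  open Graph Γ using (order; Vertex; Adj; adj?)

  IsAutomorphism : Pred (Permutation′ order) 0ℓ
  IsAutomorphism π = ∀ v w → Adj v w ⇔ Adj (π ⟨$⟩ʳ v) (π ⟨$⟩ʳ w)

  isAutomorphism? : Decidable IsAutomorphism
  isAutomorphism? π = all? λ v → all? λ w →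
    map′ (λ (p , q) → mk⇔ p q) (λ e → Equivalence.to e , Equivalence.from e)
      ((adj? v w →-dec adj? (π ⟨$⟩ʳ v) (π ⟨$⟩ʳ w)) ×-dec
       (adj? (π ⟨$⟩ʳ v) (π ⟨$⟩ʳ w) →-dec adj? v w))

  -- The fields member? and resp are needed for counting orbits constructively.

  record AutSubgroup : Set₁ where
    field
      Member       : Pred (Permutation′ order) 0ℓ
      member?      : Decidable Member
      resp         : ∀ {π ρ} → π ≈ ρ → Member π → Member ρ
      automorphism : ∀ {π} → Member π → IsAutomorphism π
      id-closed    : Member Perm.id
      ∘-closed     : ∀ {π ρ} → Member π → Member ρ → Member (π ∘ₚ ρ)
      flip-closed  : ∀ {π} → Member π → Member (flip π)

  Aut : AutSubgroup
  Aut = record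
    { Member       = IsAutomorphism
    ; member?      = isAutomorphism?
    ; resp         = λ π≈ρ a v w → subst₂ (λ x y → Adj v w ⇔ Adj x y) (π≈ρ v) (π≈ρ w) (a v w)
    ; automorphism = λ a → a
    ; id-closed    = λ v w → mk⇔ (λ p → p) (λ p → p)
    ; ∘-closed     = λ {π} a b v w → mk⇔
        (Equivalence.to (b _ _) ∘ Equivalence.to (a v w))
        (Equivalence.from (a v w) ∘ Equivalence.from (b _ _))
    ; flip-closed  = λ {π} a v w → mk⇔
        (Equivalence.from (a _ _) ∘ subst₂ Adj (sym (inverseʳ π)) (sym (inverseʳ π)))
        (subst₂ Adj (inverseʳ π) (inverseʳ π) ∘ Equivalence.to (a _ _))
    }

  ----------------------------------------------------------------------
  -- Colourings

  Colouring : ℕ → Set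
  Colouring Λ = Vertex → Fin Λ

  -- The colours are 1, …, Λ, whereas toℕ numbers the elements of Fin Λ from 0.

  colour : ∀ {Λ} → Fin Λ → ℕ
  colour c = suc (toℕ c)

  Proper : ∀ {Λ} → ℕ → Pred (Colouring Λ) 0ℓ
  Proper μ f = ∀ v w → Adj v w → f v ≢ f w ⊎ (f v ≡ f w × μ < colour (f v))

  proper? : ∀ {Λ} μ → Decidable (Proper {Λ} μ)
  proper? μ f = all? λ v → all? λ w → adj? v w →-dec
    (¬? (f v ≟ f w) ⊎-dec (f v ≟ f w ×-dec μ ℕ.<? colour (f v)))

  properColourings : (Λ μ : ℕ) → List (Colouring Λ)
  properColourings Λ μ = filter (proper? μ) (functions order Λ)

  #proper : ℕ → ℕ → ℕ
  #proper Λ μ = length (properColourings Λ μ)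

  module _ (G : AutSubgroup) where
    open AutSubgroup G

    Equivalent : ∀ {Λ} → Rel (Colouring Λ) 0ℓ
    Equivalent f f′ = ∃[ g ] Member g × (∀ v → f′ v ≡ f (g ⟨$⟩ʳ v))

    equivalent? : ∀ {Λ} → Decidable₂ (Equivalent {Λ})
    equivalent? f f′ = ∃-permutation?
      (λ g → member? g ×-dec all? (λ v → f′ v ≟ f (g ⟨$⟩ʳ v)))
      (λ π≈ρ (m , e) → resp π≈ρ m , λ v → trans (e v) (cong f (π≈ρ v)))

    #orbits : ℕ → ℕ → ℕ
    #orbits Λ μ = #classes equivalent? (properColourings Λ μ)

------------------------------------------------------------------------
-- The closed formula for complete bipartite graphs

-- A term with j > Λ vanishes when μ ≤ Λ, as then μ P j ≡ 0, so the truncated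
-- subtraction Λ ∸ j is harmless.

bipartiteFormula : (k l Λ μ : ℕ) → ℕ
bipartiteFormula k l Λ μ =
  ∑[ i ≤ k ] (k C i) * (Λ ∸ μ) ^ (k ∸ i) * (∑[ j ≤ i ] stirling₂ i j * (Λ ∸ j) ^ l * (μ P j))

{-# OPTIONS --safe #-}

-- By Burnside's lemma the number of orbits is the average number of proper colourings fixed by an
-- automorphism.  An automorphism σ ⊕ τ preserving the parts fixes exactly the proper colourings
-- pulled back along the maps to the cycles of σ and τ, of which there are as many as proper
-- colourings of K (#cycles σ) (#cycles τ).  A proper colouring fixed by an automorphism
-- exchanging the parts uses only colours above μ and is determined by a function fixed by
-- a permutation of one part; on average over all permutations there are as many of these as
-- multisets of n colours above μ.
--
-- For the closed formula, colour the vertices of the first part one at a time and record only the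
-- number u of colours ≤ μ in use: afterwards every vertex of the second part has Λ ∸ u colours.
-- Each vertex acts on functions of u by the sum of Λ ∸ μ times the identity and an operator whose
-- powers expand into Stirling numbers of the second kind, and the binomial theorem applies.  The
-- same expansion counts surjections, which identifies the recursive Stirling numbers occurring in
-- it with the numbers of partitions.

module Submission where

open import Defs
open import Data.Bool.Base using (Bool; true; false; T; not; if_then_else_)
import Data.Bool.Properties as Bool
open import Data.Fin.Base
  using (Fin; zero; suc; toℕ; fromℕ<; cast; splitAt; join; finToFun; funToFin; combine; _↑ˡ_; _↑ʳ_)
open import Data.Fin.Permutation as Perm
  using (Permutation′; permutation; _⟨$⟩ʳ_; _⟨$⟩ˡ_; _∘ₚ_; lift₀; remove; transpose; inverseˡ; inverseʳ)
import Data.Fin.Permutation.Components as PC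
open import Data.Fin.Properties as Fin using (all?; any?; finToFun-funToFin; funToFin-finToFin)
import Data.Integer.Base as ℤ
import Data.Integer.Properties as ℤ
open import Data.List.Base
  using (List; []; _∷_; _++_; map; filter; length; lookup; deduplicate; allFin; tabulate;
         upTo; applyUpTo; cartesianProduct; cartesianProductWith)
open import Data.List.Properties
  using (map-++; map-∘; map-cong; map-upTo; map-applyUpTo; map-tabulate; length-tabulate; lookup-tabulate)
open import Data.List.Membership.Propositional using (_∈_)
open import Data.List.Membership.Propositional.Properties using (∈-allFin; ∈-upTo⁻)
import Data.List.Relation.Unary.All as All
import Data.List.Relation.Unary.All.Properties as All
open import Data.List.Relation.Unary.Any using (here; there)
open import Data.Nat.Base using (ℕ; zero; suc; _≤ᵇ_; _+_; _*_; _∸_; _^_; _≤_; _<_; _!; NonZero; z≤n; s≤s)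
open import Data.Nat.Combinatorics.Base using (_P′_)
open import Data.Nat.Combinatorics using (_C_; _P_; k>n⇒nCk≡0; nCk+nC[k+1]≡[n+1]C[k+1]; nPn≡n!)
open import Data.Nat.DivMod as ℕ using (_%_; m%n<n; m≡m%n+[m/n]*n)
open import Data.Nat.GeneralisedArithmetic using (iterate)
open import Data.Nat.ListAction using (sum)
open import Data.Nat.ListAction.Properties using (sum-++)
open import Data.Nat.Properties as ℕ
  using (+-identityʳ; +-comm; +-assoc; *-identityˡ; *-identityʳ; *-zeroʳ; *-comm; *-assoc;
         *-distribˡ-+; *-distribʳ-+; _!≢0; _!*_!≢0; m*n≢0)
open import Data.Nat.Tactic.RingSolver using (solve-∀)
open import Data.Product.Base using (_×_; _,_; proj₁; proj₂; ∃-syntax)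
open import Data.Product.Relation.Binary.Pointwise.NonDependent using (×-decSetoid)
open import Data.Rational.Base using (_/_; ½; toℚᵘ) renaming (_+_ to _+ℚ_; _*_ to _*ℚ_)
import Data.Rational.Properties as ℚ
open import Data.Rational.Unnormalised.Base as ℚᵘ using (mkℚᵘ; *≡*)
import Data.Rational.Unnormalised.Properties as ℚᵘ
open import Data.Sum.Base using (_⊎_; inj₁; inj₂; [_,_]′)
open import Data.Unit.Base using (tt)
import Data.Vec.Functional as Vector
import Data.Vec.Functional.Properties as Vector
open import Function.Base using (_∘_; const)
open import Function.Bundles using (mk⇔; Equivalence)
open import Level using (0ℓ)
open import Relation.Binary.Bundles using (DecSetoid)
open import Relation.Binary.Definitions using () renaming (Decidable to Decidable₂)
open import Relation.Binary.Structures using (IsEquivalence)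
open import Relation.Binary.PropositionalEquality
  using (_≡_; _≢_; _≗_; refl; sym; trans; cong; cong₂; subst; module ≡-Reasoning)
open import Relation.Nullary using (¬_; Dec; yes; no; does; contradiction)
open import Relation.Nullary.Decidable using (¬?; _×-dec_; decidable-stable)
open import Relation.Unary using (Pred; Decidable)

open ≡-Reasoning

-- Without function extensionality, the lists of functions and permutations meet each element
-- exactly once only up to pointwise equality. Every count is therefore a sum of 0-1 indicators,
-- bijections act through double counting, and summands have to respect the setoid. Averages stay in
-- ℕ, multiplied out by the group order, until the very end.
--
-- The multiset term comes from inserting the point 0 into a permutation: as a cycle of its own it
-- may take any of d colours, and in front of one of the n other points it inherits a colour. Each
-- insertion thus contributes a factor d + n, and a rising factorial results.
--
-- The operator `step` expands into Stirling numbers because, when all μ colours are small, its i-th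
-- power at 0 weighs each function on i points by its number of values, and S(i,j) μ(μ-1)⋯(μ-j+1) of
-- these functions have exactly j values. For μ = j and the indicator of j as weight, only the
-- surjections remain.

private
  variable
    A B D : Set
    X Y : Set
    k m n : ℕ

-- Indicators and finite sums

⟦_⟧ : Dec X → ℕ
⟦ d ⟧ = if does d then 1 else 0

⟦⟧-yes : (d : Dec X) → X → ⟦ d ⟧ ≡ 1
⟦⟧-yes (yes _) _ = refl
⟦⟧-yes (no ¬p) p = contradiction p ¬p

⟦⟧-no : (d : Dec X) → ¬ X → ⟦ d ⟧ ≡ 0
⟦⟧-no (yes p) ¬p = contradiction p ¬p
⟦⟧-no (no _)  _  = refl

-- The factors have to agree only where the condition holds, so a summand may be rewritten using the
-- fact that it selects.
⟦⟧*-cong : (d : Dec X) (e : Dec Y) {a b : ℕ} → (X → Y) → (Y → X) → (X → a ≡ b) →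
           ⟦ d ⟧ * a ≡ ⟦ e ⟧ * b
⟦⟧*-cong (yes p) (yes q) f g h = cong (1 *_) (h p)
⟦⟧*-cong (yes p) (no ¬q) f g h = contradiction (f p) ¬q
⟦⟧*-cong (no ¬p) (yes q) f g h = contradiction (g q) ¬p
⟦⟧*-cong (no ¬p) (no ¬q) f g h = refl

⟦⟧-cong : (d : Dec X) (e : Dec Y) → (X → Y) → (Y → X) → ⟦ d ⟧ ≡ ⟦ e ⟧
⟦⟧-cong d e f g = trans (sym (*-identityʳ ⟦ d ⟧))
  (trans (⟦⟧*-cong d e f g (λ _ → refl)) (*-identityʳ ⟦ e ⟧))

⟦⟧-elim : (d : Dec X) {c : ℕ} → (X → 1 ≡ c) → (¬ X → 0 ≡ c) → ⟦ d ⟧ ≡ c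
⟦⟧-elim (yes p) h _ = h p
⟦⟧-elim (no ¬p) _ h = h ¬p

⟦⟧*-elim : (d : Dec X) {a c : ℕ} → (X → a ≡ c) → (¬ X → 0 ≡ c) → ⟦ d ⟧ * a ≡ c
⟦⟧*-elim (yes p) h _ = trans (*-identityˡ _) (h p)
⟦⟧*-elim (no ¬p) _ h = h ¬p

⟦⟧-× : (d : Dec X) (e : Dec Y) → ⟦ d ×-dec e ⟧ ≡ ⟦ d ⟧ * ⟦ e ⟧
⟦⟧-× (yes _) (yes _) = refl
⟦⟧-× (yes _) (no _)  = refl
⟦⟧-× (no _)  _       = refl

∑ : List A → (A → ℕ) → ℕ
∑ xs f = sum (map f xs)

syntax ∑ xs (λ x → e) = ∑[ x ∈ xs ] e
infix 5 ∑

∑-cong-∈ : (xs : List A) {f g : A → ℕ} → (∀ {x} → x ∈ xs → f x ≡ g x) → ∑ xs f ≡ ∑ xs g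
∑-cong-∈ []       f≡g = refl
∑-cong-∈ (x ∷ xs) f≡g = cong₂ _+_ (f≡g (here refl)) (∑-cong-∈ xs (f≡g ∘ there))

∑-cong : (xs : List A) {f g : A → ℕ} → f ≗ g → ∑ xs f ≡ ∑ xs g
∑-cong xs f≗g = cong sum (map-cong f≗g xs)

∑-const : (xs : List A) (c : ℕ) → ∑ xs (const c) ≡ length xs * c
∑-const []       c = refl
∑-const (x ∷ xs) c = cong (c +_) (∑-const xs c)

∑-zero : (xs : List A) → ∑[ x ∈ xs ] 0 ≡ 0
∑-zero xs = trans (∑-const xs 0) (*-zeroʳ (length xs))

∑-one : (xs : List A) → ∑[ x ∈ xs ] 1 ≡ length xs
∑-one xs = trans (∑-const xs 1) (*-identityʳ (length xs))

∑-+ : (xs : List A) (f g : A → ℕ) → ∑[ x ∈ xs ] f x + g x ≡ ∑ xs f + ∑ xs g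
∑-+ []       f g = refl
∑-+ (x ∷ xs) f g = trans (cong (f x + g x +_) (∑-+ xs f g)) (interchange (f x) (g x) _ _)
  where
  interchange : ∀ a b c d → (a + b) + (c + d) ≡ (a + c) + (b + d)
  interchange = solve-∀

∑-*ˡ : (xs : List A) (c : ℕ) (f : A → ℕ) → ∑[ x ∈ xs ] c * f x ≡ c * ∑ xs f
∑-*ˡ []       c f = sym (*-zeroʳ c)
∑-*ˡ (x ∷ xs) c f = trans (cong (c * f x +_) (∑-*ˡ xs c f)) (sym (*-distribˡ-+ c (f x) _))

∑-*ʳ : (xs : List A) (c : ℕ) (f : A → ℕ) → ∑[ x ∈ xs ] f x * c ≡ ∑ xs f * c
∑-*ʳ xs c f = trans (∑-cong xs (λ x → *-comm (f x) c)) (trans (∑-*ˡ xs c f) (*-comm c _))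

∑-swap : (xs : List A) (ys : List B) (f : A → B → ℕ) →
         ∑[ x ∈ xs ] ∑[ y ∈ ys ] f x y ≡ ∑[ y ∈ ys ] ∑[ x ∈ xs ] f x y
∑-swap []       ys f = sym (∑-zero ys)
∑-swap (x ∷ xs) ys f = trans (cong (∑ ys (f x) +_) (∑-swap xs ys f)) (sym (∑-+ ys (f x) _))

∑-++ : (xs ys : List A) (f : A → ℕ) → ∑ (xs ++ ys) f ≡ ∑ xs f + ∑ ys f
∑-++ xs ys f = trans (cong sum (map-++ f xs ys)) (sum-++ (map f xs) (map f ys))

∑-map : (xs : List A) (h : A → B) (f : B → ℕ) → ∑ (map h xs) f ≡ ∑[ x ∈ xs ] f (h x)
∑-map xs h f = cong sum (sym (map-∘ xs))

∑-cartesianProductWith : (xs : List A) (ys : List B) (h : A → B → D) (f : D → ℕ) →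
  ∑ (cartesianProductWith h xs ys) f ≡ ∑[ x ∈ xs ] ∑[ y ∈ ys ] f (h x y)
∑-cartesianProductWith []       ys h f = refl
∑-cartesianProductWith (x ∷ xs) ys h f = trans
  (∑-++ (map (h x) ys) (cartesianProductWith h xs ys) f)
  (cong₂ _+_ (∑-map ys (h x) f) (∑-cartesianProductWith xs ys h f))

∑-filter : {P : Pred A 0ℓ} (P? : Decidable P) (xs : List A) (f : A → ℕ) →
           ∑ (filter P? xs) f ≡ ∑[ x ∈ xs ] ⟦ P? x ⟧ * f x
∑-filter P? []       f = refl
∑-filter P? (x ∷ xs) f with P? x
... | yes _ = cong₂ _+_ (sym (*-identityˡ (f x))) (∑-filter P? xs f)
... | no  _ = ∑-filter P? xs f

length-filter≡∑ : {P : Pred A 0ℓ} (P? : Decidable P) (xs : List A) →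
                  length (filter P? xs) ≡ ∑[ x ∈ xs ] ⟦ P? x ⟧
length-filter≡∑ P? xs = trans (sym (∑-one (filter P? xs)))
  (trans (∑-filter P? xs (const 1)) (∑-cong xs (λ x → *-identityʳ ⟦ P? x ⟧)))

∑≤-upTo : ∀ n (f : ℕ → ℕ) → ∑≤ n f ≡ ∑ (upTo (suc n)) f
∑≤-upTo n f = cong sum (sym (map-upTo f (suc n)))

-- Enumerations of decidable setoids

-- Counting hits up to `_≈_` expresses completeness and absence of repetitions at once, and in the
-- form in which both enter the sums.
record Enumerates (S : DecSetoid 0ℓ 0ℓ) (xs : List (DecSetoid.Carrier S)) : Set where
  constructor enumerates
  open DecSetoid S using (_≟_)
  field once : ∀ a → ∑[ x ∈ xs ] ⟦ x ≟ a ⟧ ≡ 1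

open Enumerates

×-enumerates : (S T : DecSetoid 0ℓ 0ℓ) {xs : List (DecSetoid.Carrier S)} {ys : List (DecSetoid.Carrier T)} →
               Enumerates S xs → Enumerates T ys → Enumerates (×-decSetoid S T) (cartesianProduct xs ys)
×-enumerates S T {xs} {ys} exs eys .once (a , b) = begin
  ∑[ z ∈ cartesianProduct xs ys ] ⟦ z ST.≟ (a , b) ⟧
    ≡⟨ ∑-cartesianProductWith xs ys _,_ _ ⟩
  ∑[ x ∈ xs ] ∑[ y ∈ ys ] ⟦ (x , y) ST.≟ (a , b) ⟧
    ≡⟨ ∑-cong xs (λ x → ∑-cong ys λ y → ⟦⟧-× (x S.≟ a) (y T.≟ b)) ⟩
  ∑[ x ∈ xs ] ∑[ y ∈ ys ] ⟦ x S.≟ a ⟧ * ⟦ y T.≟ b ⟧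
    ≡⟨ ∑-cong xs (λ x → ∑-*ˡ ys ⟦ x S.≟ a ⟧ _) ⟩
  ∑[ x ∈ xs ] ⟦ x S.≟ a ⟧ * (∑[ y ∈ ys ] ⟦ y T.≟ b ⟧)
    ≡⟨ ∑-cong xs (λ x → trans (cong (⟦ x S.≟ a ⟧ *_) (once eys b)) (*-identityʳ _)) ⟩
  ∑[ x ∈ xs ] ⟦ x S.≟ a ⟧
    ≡⟨ once exs a ⟩
  1 ∎
  where
  module S = DecSetoid S
  module T = DecSetoid T
  module ST = DecSetoid (×-decSetoid S T)

module _ (S : DecSetoid 0ℓ 0ℓ) {xs : List (DecSetoid.Carrier S)} (exs : Enumerates S xs) where
  open DecSetoid S using (Carrier; _≈_; _≟_)

  ∑-single : ∀ {P : Pred Carrier 0ℓ} (P? : Decidable P) a {c} (f : Carrier → ℕ) →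
             (∀ {x} → P x → x ≈ a) → (∀ {x} → x ≈ a → P x) → (∀ {x} → x ≈ a → f x ≡ c) →
             ∑[ x ∈ xs ] ⟦ P? x ⟧ * f x ≡ c
  ∑-single P? a {c} f to from f≡c = begin
    ∑[ x ∈ xs ] ⟦ P? x ⟧ * f x ≡⟨ ∑-cong xs (λ x → ⟦⟧*-cong (P? x) (x ≟ a) to from (f≡c ∘ to)) ⟩
    ∑[ x ∈ xs ] ⟦ x ≟ a ⟧ * c  ≡⟨ ∑-*ʳ xs c _ ⟩
    ∑ xs _ * c                 ≡⟨ cong (_* c) (once exs a) ⟩
    1 * c                      ≡⟨ *-identityˡ c ⟩
    c                          ∎

  count-single : ∀ {P : Pred Carrier 0ℓ} (P? : Decidable P) a →
                 (∀ {x} → P x → x ≈ a) → (∀ {x} → x ≈ a → P x) → ∑[ x ∈ xs ] ⟦ P? x ⟧ ≡ 1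
  count-single P? a to from = trans (∑-cong xs (λ x → sym (*-identityʳ ⟦ P? x ⟧)))
    (∑-single P? a (const 1) to from (λ _ → refl))

module _ (S T : DecSetoid 0ℓ 0ℓ)
         {xs : List (DecSetoid.Carrier S)} (exs : Enumerates S xs)
         {ys : List (DecSetoid.Carrier T)} (eys : Enumerates T ys) where
  private
    module S = DecSetoid S
    module T = DecSetoid T

  -- Double counting of the pairs with `P x` and `y ≈ φ x`: the hypotheses say that these are the
  -- pairs with `Q y` and `x ≈ ψ y`. Phrasing them relationally makes `φ` and `ψ` inverse to each
  -- other on `P` and `Q` only, and includes compatibility with the two equalities.
  ∑-transfer : {P : Pred S.Carrier 0ℓ} {Q : Pred T.Carrier 0ℓ} (P? : Decidable P) (Q? : Decidable Q)
               (φ : S.Carrier → T.Carrier) (ψ : T.Carrier → S.Carrier)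
               (f : S.Carrier → ℕ) (g : T.Carrier → ℕ) →
               (∀ {x y} → P x → y T.≈ φ x → Q y × x S.≈ ψ y) →
               (∀ {x y} → Q y → x S.≈ ψ y → P x × y T.≈ φ x) →
               (∀ {x y} → P x → y T.≈ φ x → f x ≡ g y) →
               ∑[ x ∈ xs ] ⟦ P? x ⟧ * f x ≡ ∑[ y ∈ ys ] ⟦ Q? y ⟧ * g y
  ∑-transfer P? Q? φ ψ f g to from f≡g = begin
    ∑[ x ∈ xs ] ⟦ P? x ⟧ * f x
      ≡⟨ ∑-cong xs (λ x → sym (∑-single T eys (λ y → y T.≟ φ x) (φ x) (const (⟦ P? x ⟧ * f x))
                                (λ e → e) (λ e → e) (λ _ → refl))) ⟩
    ∑[ x ∈ xs ] ∑[ y ∈ ys ] ⟦ y T.≟ φ x ⟧ * (⟦ P? x ⟧ * f x)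
      ≡⟨ ∑-swap xs ys _ ⟩
    ∑[ y ∈ ys ] ∑[ x ∈ xs ] ⟦ y T.≟ φ x ⟧ * (⟦ P? x ⟧ * f x)
      ≡⟨ ∑-cong ys (λ y → ∑-cong xs λ x → guarded (y T.≟ φ x) (P? x) (x S.≟ ψ y) (Q? y)
           (λ e p → proj₂ (to p e)) (λ e p → proj₁ (to p e))
           (λ e q → proj₂ (from q e)) (λ e q → proj₁ (from q e))
           (λ e p → f≡g p e)) ⟩
    ∑[ y ∈ ys ] ∑[ x ∈ xs ] ⟦ x S.≟ ψ y ⟧ * (⟦ Q? y ⟧ * g y)
      ≡⟨ ∑-cong ys (λ y → ∑-single S exs (λ x → x S.≟ ψ y) (ψ y) (const (⟦ Q? y ⟧ * g y))
                            (λ e → e) (λ e → e) (λ _ → refl)) ⟩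
    ∑[ y ∈ ys ] ⟦ Q? y ⟧ * g y ∎
    where
    guarded : ∀ {P₁ P₂ Q₁ Q₂ : Set} (d₁ : Dec P₁) (d₂ : Dec P₂) (e₁ : Dec Q₁) (e₂ : Dec Q₂) {a b} →
              (P₁ → P₂ → Q₁) → (P₁ → P₂ → Q₂) → (Q₁ → Q₂ → P₁) → (Q₁ → Q₂ → P₂) →
              (P₁ → P₂ → a ≡ b) → ⟦ d₁ ⟧ * (⟦ d₂ ⟧ * a) ≡ ⟦ e₁ ⟧ * (⟦ e₂ ⟧ * b)
    guarded d₁ d₂ e₁ e₂ {a} {b} h₁ h₂ k₁ k₂ a≡b = begin
      ⟦ d₁ ⟧ * (⟦ d₂ ⟧ * a)  ≡⟨ *-assoc ⟦ d₁ ⟧ ⟦ d₂ ⟧ a ⟨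
      ⟦ d₁ ⟧ * ⟦ d₂ ⟧ * a    ≡⟨ cong (_* a) (⟦⟧-× d₁ d₂) ⟨
      ⟦ d₁ ×-dec d₂ ⟧ * a    ≡⟨ ⟦⟧*-cong (d₁ ×-dec d₂) (e₁ ×-dec e₂)
                                  (λ (p , q) → h₁ p q , h₂ p q) (λ (p , q) → k₁ p q , k₂ p q)
                                  (λ (p , q) → a≡b p q) ⟩
      ⟦ e₁ ×-dec e₂ ⟧ * b    ≡⟨ cong (_* b) (⟦⟧-× e₁ e₂) ⟩
      ⟦ e₁ ⟧ * ⟦ e₂ ⟧ * b    ≡⟨ *-assoc ⟦ e₁ ⟧ ⟦ e₂ ⟧ b ⟩
      ⟦ e₁ ⟧ * (⟦ e₂ ⟧ * b)  ∎

  ∑-reindex : (φ : S.Carrier → T.Carrier) (ψ : T.Carrier → S.Carrier)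
              (f : S.Carrier → ℕ) (g : T.Carrier → ℕ) →
              (∀ {x y} → y T.≈ φ x → x S.≈ ψ y) → (∀ {x y} → x S.≈ ψ y → y T.≈ φ x) →
              (∀ {x y} → y T.≈ φ x → f x ≡ g y) → ∑ xs f ≡ ∑ ys g
  ∑-reindex φ ψ f g to from f≡g = begin
    ∑ xs f                       ≡⟨ ∑-cong xs (λ x → sym (*-identityˡ (f x))) ⟩
    ∑[ x ∈ xs ] ⟦ yes tt ⟧ * f x ≡⟨ ∑-transfer (λ _ → yes tt) (λ _ → yes tt) φ ψ f g
                                      (λ _ e → tt , to e) (λ _ e → tt , from e) (λ _ → f≡g) ⟩
    ∑[ y ∈ ys ] ⟦ yes tt ⟧ * g y ≡⟨ ∑-cong ys (λ y → *-identityˡ (g y)) ⟩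
    ∑ ys g                       ∎

  count-transfer : {P : Pred S.Carrier 0ℓ} {Q : Pred T.Carrier 0ℓ} (P? : Decidable P) (Q? : Decidable Q)
                   (φ : S.Carrier → T.Carrier) (ψ : T.Carrier → S.Carrier) →
                   (∀ {x y} → P x → y T.≈ φ x → Q y × x S.≈ ψ y) →
                   (∀ {x y} → Q y → x S.≈ ψ y → P x × y T.≈ φ x) →
                   ∑[ x ∈ xs ] ⟦ P? x ⟧ ≡ ∑[ y ∈ ys ] ⟦ Q? y ⟧
  count-transfer P? Q? φ ψ to from = begin
    ∑[ x ∈ xs ] ⟦ P? x ⟧     ≡⟨ ∑-cong xs (λ x → sym (*-identityʳ ⟦ P? x ⟧)) ⟩
    ∑[ x ∈ xs ] ⟦ P? x ⟧ * 1 ≡⟨ ∑-transfer P? Q? φ ψ (const 1) (const 1) to from (λ _ _ → refl) ⟩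
    ∑[ y ∈ ys ] ⟦ Q? y ⟧ * 1 ≡⟨ ∑-cong ys (λ y → *-identityʳ ⟦ Q? y ⟧) ⟩
    ∑[ y ∈ ys ] ⟦ Q? y ⟧     ∎

-- Counting classes

module _ {R : A → A → Set} (R? : Decidable₂ R) (isEq : IsEquivalence R) where
  private module R = IsEquivalence isEq

  -- `deduplicate` keeps the head and filters out whatever is related to it. If the head is related
  -- to `x`, nothing else related to `x` survives; otherwise the filter discards nothing that is
  -- related to `x`.
  ∑-representatives : ∀ {x} (xs : List A) → x ∈ xs → ∑[ r ∈ deduplicate R? xs ] ⟦ R? r x ⟧ ≡ 1
  ∑-representatives {x} (y ∷ ys) x∈ with R? y x
  ... | yes yRx = cong suc (begin
    ∑[ r ∈ filter (¬? ∘ R? y) (deduplicate R? ys) ] ⟦ R? r x ⟧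
      ≡⟨ ∑-filter (¬? ∘ R? y) (deduplicate R? ys) _ ⟩
    ∑[ r ∈ deduplicate R? ys ] ⟦ ¬? (R? y r) ⟧ * ⟦ R? r x ⟧
      ≡⟨ ∑-cong (deduplicate R? ys) (λ r → trans (sym (⟦⟧-× (¬? (R? y r)) (R? r x)))
           (⟦⟧-no (¬? (R? y r) ×-dec R? r x) λ (¬yRr , rRx) → ¬yRr (R.trans yRx (R.sym rRx)))) ⟩
    ∑[ r ∈ deduplicate R? ys ] 0
      ≡⟨ ∑-zero (deduplicate R? ys) ⟩
    0 ∎)
  ∑-representatives {x} (y ∷ ys) (here x≡y)   | no ¬yRx = contradiction (R.reflexive (sym x≡y)) ¬yRx
  ∑-representatives {x} (y ∷ ys) (there x∈ys) | no ¬yRx = begin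
    ∑[ r ∈ filter (¬? ∘ R? y) (deduplicate R? ys) ] ⟦ R? r x ⟧
      ≡⟨ ∑-filter (¬? ∘ R? y) (deduplicate R? ys) _ ⟩
    ∑[ r ∈ deduplicate R? ys ] ⟦ ¬? (R? y r) ⟧ * ⟦ R? r x ⟧
      ≡⟨ ∑-cong (deduplicate R? ys) (λ r → trans (sym (⟦⟧-× (¬? (R? y r)) (R? r x)))
           (⟦⟧-cong (¬? (R? y r) ×-dec R? r x) (R? r x) proj₂
             λ rRx → (λ yRr → ¬yRx (R.trans yRr rRx)) , rRx)) ⟩
    ∑[ r ∈ deduplicate R? ys ] ⟦ R? r x ⟧
      ≡⟨ ∑-representatives ys x∈ys ⟩
    1 ∎

  -- Each element is counted with its unique representative. The weight covers two uses: stabiliser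
  -- sizes for Burnside's lemma, and the constant 1 for classes of equal size.
  #classes-* : ∀ (xs : List A) (w : A → ℕ) N →
               (∀ {r} → r ∈ deduplicate R? xs → ∑[ x ∈ xs ] ⟦ R? r x ⟧ * w x ≡ N) →
               #classes R? xs * N ≡ ∑ xs w
  #classes-* xs w N classWeight = begin
    #classes R? xs * N
      ≡⟨ ∑-const (deduplicate R? xs) N ⟨
    ∑[ r ∈ deduplicate R? xs ] N
      ≡⟨ ∑-cong-∈ (deduplicate R? xs) (sym ∘ classWeight) ⟩
    ∑[ r ∈ deduplicate R? xs ] ∑[ x ∈ xs ] ⟦ R? r x ⟧ * w x
      ≡⟨ ∑-swap (deduplicate R? xs) xs _ ⟩
    ∑[ x ∈ xs ] ∑[ r ∈ deduplicate R? xs ] ⟦ R? r x ⟧ * w x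
      ≡⟨ ∑-cong-∈ xs (λ {x} x∈xs → trans (∑-*ʳ (deduplicate R? xs) (w x) _)
           (trans (cong (_* w x) (∑-representatives xs x∈xs)) (*-identityˡ (w x)))) ⟩
    ∑ xs w ∎

-- Enumerating finite sets, functions and permutations

∑-allFin-suc : ∀ n (f : Fin (suc n) → ℕ) →
               ∑ (allFin (suc n)) f ≡ f zero + (∑[ i ∈ allFin n ] f (suc i))
∑-allFin-suc n f = cong (f zero +_) (begin
  ∑ (tabulate suc) f      ≡⟨ cong sum (map-tabulate suc f) ⟩
  sum (tabulate (f ∘ suc)) ≡⟨ cong sum (map-tabulate (λ i → i) (f ∘ suc)) ⟨
  ∑ (allFin n) (f ∘ suc)  ∎)

∑-allFin-const : ∀ n c → ∑[ i ∈ allFin n ] c ≡ n * c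
∑-allFin-const n c = trans (∑-const (allFin n) c) (cong (_* c) (length-tabulate {n = n} (λ i → i)))

allFin-enumerates : ∀ n → Enumerates (Fin.≡-decSetoid n) (allFin n)
allFin-enumerates (suc n) .once zero = begin
  ∑[ i ∈ allFin (suc n) ] ⟦ i Fin.≟ zero ⟧ ≡⟨ ∑-allFin-suc n (λ i → ⟦ i Fin.≟ zero ⟧) ⟩
  suc (∑[ i ∈ allFin n ] 0)                ≡⟨ cong suc (∑-zero (allFin n)) ⟩
  1                                        ∎
allFin-enumerates (suc n) .once (suc a) = begin
  ∑[ i ∈ allFin (suc n) ] ⟦ i Fin.≟ suc a ⟧ ≡⟨ ∑-allFin-suc n (λ i → ⟦ i Fin.≟ suc a ⟧) ⟩
  ∑[ i ∈ allFin n ] ⟦ suc i Fin.≟ suc a ⟧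
    ≡⟨ ∑-cong (allFin n) (λ i → ⟦⟧-cong (suc i Fin.≟ suc a) (i Fin.≟ a) Fin.suc-injective (cong suc)) ⟩
  ∑[ i ∈ allFin n ] ⟦ i Fin.≟ a ⟧           ≡⟨ once (allFin-enumerates n) a ⟩
  1                                         ∎

_≗?_ : (f g : Fin n → Fin k) → Dec (f ≗ g)
_≗?_ = Vector.≗-dec Fin._≟_

functionDecSetoid : ℕ → ℕ → DecSetoid 0ℓ 0ℓ
functionDecSetoid n k = record
  { Carrier          = Fin n → Fin k
  ; _≈_              = _≗_
  ; isDecEquivalence = record
    { isEquivalence = record
      { refl  = λ _ → refl
      ; sym   = λ f≗g i → sym (f≗g i)
      ; trans = λ f≗g g≗h i → trans (f≗g i) (g≗h i)
      }
    ; _≟_ = _≗?_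
    }
  }

permutationDecSetoid : ℕ → DecSetoid 0ℓ 0ℓ
permutationDecSetoid n = record
  { Carrier          = Permutation′ n
  ; _≈_              = Perm._≈_
  ; isDecEquivalence = record
    { isEquivalence = record
      { refl  = λ _ → refl
      ; sym   = λ π≈ρ i → sym (π≈ρ i)
      ; trans = λ π≈ρ ρ≈σ i → trans (π≈ρ i) (ρ≈σ i)
      }
    ; _≟_ = λ π ρ → (π ⟨$⟩ʳ_) ≗? (ρ ⟨$⟩ʳ_)
    }
  }

funToFin-cong : {f g : Fin n → Fin k} → f ≗ g → funToFin f ≡ funToFin g
funToFin-cong {zero}  f≗g = refl
funToFin-cong {suc n} f≗g = cong₂ combine (f≗g zero) (funToFin-cong (f≗g ∘ suc))

functions-enumerates : ∀ n k → Enumerates (functionDecSetoid n k) (functions n k)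
functions-enumerates n k .once f = trans (∑-map (allFin (k ^ n)) finToFun _)
  (count-single (Fin.≡-decSetoid (k ^ n)) (allFin-enumerates (k ^ n)) (λ i → finToFun i ≗? f) (funToFin f)
    (λ {i} e → trans (sym (funToFin-finToFin {n} {k} i)) (funToFin-cong e))
    (λ { refl → finToFun-funToFin f }))

-- A function agrees only pointwise with its head consed onto its tail, whence the congruence
-- hypothesis on `F`.
∑-functions-suc : ∀ n k (F : (Fin (suc n) → Fin k) → ℕ) → (∀ {f g} → f ≗ g → F f ≡ F g) →
                  ∑ (functions (suc n) k) F ≡ ∑[ c ∈ allFin k ] ∑[ f ∈ functions n k ] F (c Vector.∷ f)
∑-functions-suc n k F F-cong = trans
  (∑-reindex (functionDecSetoid (suc n) k) (×-decSetoid (Fin.≡-decSetoid k) (functionDecSetoid n k))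
    (functions-enumerates (suc n) k)
    (×-enumerates (Fin.≡-decSetoid k) (functionDecSetoid n k) (allFin-enumerates k) (functions-enumerates n k))
    (λ f → Vector.head f , Vector.tail f) (λ (c , f) → c Vector.∷ f) F (λ (c , f) → F (c Vector.∷ f))
    (λ {f} (c≡ , t≗) → λ { zero → sym c≡ ; (suc i) → sym (t≗ i) })
    (λ e → sym (e zero) , λ i → sym (e (suc i)))
    (λ {f} (c≡ , t≗) → F-cong λ { zero → sym c≡ ; (suc i) → sym (t≗ i) }))
  (∑-cartesianProductWith (allFin k) (functions n k) _,_ _)

∑-functions-+ : ∀ m n k (F : (Fin (m + n) → Fin k) → ℕ) → (∀ {f g} → f ≗ g → F f ≡ F g) →
                ∑ (functions (m + n) k) F ≡ ∑[ a ∈ functions m k ] ∑[ b ∈ functions n k ] F (a Vector.++ b)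
∑-functions-+ m n k F F-cong = trans
  (∑-reindex (functionDecSetoid (m + n) k) (×-decSetoid (functionDecSetoid m k) (functionDecSetoid n k))
    (functions-enumerates (m + n) k)
    (×-enumerates (functionDecSetoid m k) (functionDecSetoid n k) (functions-enumerates m k) (functions-enumerates n k))
    (λ f → f ∘ (_↑ˡ n) , f ∘ (m ↑ʳ_)) (λ (a , b) → a Vector.++ b) F (λ (a , b) → F (a Vector.++ b))
    to
    (λ {f} {(a , b)} e → (λ i → trans (sym (Vector.lookup-++ˡ a b i)) (sym (e (i ↑ˡ n)))) ,
                         (λ i → trans (sym (Vector.lookup-++ʳ a b i)) (sym (e (m ↑ʳ i)))))
    (F-cong ∘ to))
  (∑-cartesianProductWith (functions m k) (functions n k) _,_ _)
  where
  to : ∀ {f : Fin (m + n) → Fin k} {(a , b) : (Fin m → Fin k) × (Fin n → Fin k)} →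
       (a ≗ f ∘ (_↑ˡ n)) × (b ≗ f ∘ (m ↑ʳ_)) → f ≗ a Vector.++ b
  to {f} {a , b} (a≗ , b≗) i with splitAt m i in eq
  ... | inj₁ j = trans (cong f (sym (Fin.splitAt⁻¹-↑ˡ eq))) (sym (a≗ j))
  ... | inj₂ j = trans (cong f (sym (Fin.splitAt⁻¹-↑ʳ eq))) (sym (b≗ j))

∑-permutations-suc : ∀ n (F : Permutation′ (suc n) → ℕ) → ∑ (permutations (suc n)) F ≡
  ∑[ j ∈ allFin (suc n) ] ∑[ π ∈ permutations n ] F (lift₀ π ∘ₚ transpose zero j)
∑-permutations-suc n F = ∑-cartesianProductWith (allFin (suc n)) (permutations n) _ F

transpose-involutive : ∀ (i j k : Fin n) → PC.transpose j i (PC.transpose i j k) ≡ k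
transpose-involutive i j k = PC.transpose-inverse j i

permutations-enumerates : ∀ n → Enumerates (permutationDecSetoid n) (permutations n)
permutations-enumerates zero    .once σ = refl
permutations-enumerates (suc n) .once σ = begin
  ∑[ π ∈ permutations (suc n) ] ⟦ (π ⟨$⟩ʳ_) ≗? (σ ⟨$⟩ʳ_) ⟧
    ≡⟨ ∑-permutations-suc n _ ⟩
  ∑[ j ∈ allFin (suc n) ] ∑[ π ∈ permutations n ] ⟦ (lift₀ π ∘ₚ transpose zero j ⟨$⟩ʳ_) ≗? (σ ⟨$⟩ʳ_) ⟧
    ≡⟨ ∑-cartesianProductWith (allFin (suc n)) (permutations n) _,_ _ ⟨
  ∑[ (j , π) ∈ cartesianProduct (allFin (suc n)) (permutations n) ] ⟦ (lift₀ π ∘ₚ transpose zero j ⟨$⟩ʳ_) ≗? (σ ⟨$⟩ʳ_) ⟧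
    ≡⟨ count-single (×-decSetoid (Fin.≡-decSetoid (suc n)) (permutationDecSetoid n))
         (×-enumerates _ _ (allFin-enumerates (suc n)) (permutations-enumerates n))
         (λ (j , π) → (lift₀ π ∘ₚ transpose zero j ⟨$⟩ʳ_) ≗? (σ ⟨$⟩ʳ_)) (σ ⟨$⟩ʳ zero , remove zero τ)
         to (λ { {j , π} (refl , π≈) → from π π≈ }) ⟩
  1 ∎
  where
  τ : Permutation′ (suc n)
  τ = σ ∘ₚ transpose (σ ⟨$⟩ʳ zero) zero
  lift₀-τ : lift₀ (remove zero τ) Perm.≈ τ
  lift₀-τ = Perm.lift₀-remove τ (τ-fixes-zero (σ ⟨$⟩ʳ zero))
    where
    τ-fixes-zero : ∀ j → PC.transpose j zero j ≡ zero
    -- `PC.transpose zero j zero` reduces to `j`.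
    τ-fixes-zero j = transpose-involutive zero j zero
  to : ∀ {(j , π) : Fin (suc n) × Permutation′ n} → lift₀ π ∘ₚ transpose zero j Perm.≈ σ →
       (j ≡ σ ⟨$⟩ʳ zero) × (π Perm.≈ remove zero τ)
  -- `lift₀ π` fixes `zero`, so at `zero` the hypothesis reads `j ≡ σ ⟨$⟩ʳ zero`. Undoing the
  -- transposition then recovers `π` at the other points.
  to {j , π} e with refl ← e zero = refl , λ i → Fin.suc-injective (begin
    suc (π ⟨$⟩ʳ i)                               ≡⟨ transpose-involutive zero j (suc (π ⟨$⟩ʳ i)) ⟨
    PC.transpose j zero (PC.transpose zero j (suc (π ⟨$⟩ʳ i))) ≡⟨ cong (PC.transpose j zero) (e (suc i)) ⟩
    τ ⟨$⟩ʳ suc i                                 ≡⟨ lift₀-τ (suc i) ⟨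
    suc (remove zero τ ⟨$⟩ʳ i)                   ∎)
  from : ∀ π → π Perm.≈ remove zero τ → lift₀ π ∘ₚ transpose zero (σ ⟨$⟩ʳ zero) Perm.≈ σ
  from π π≈ i = trans
    (cong (PC.transpose zero (σ ⟨$⟩ʳ zero)) (trans (Perm.lift₀-cong π (remove zero τ) π≈ i) (lift₀-τ i)))
    (PC.transpose-inverse zero (σ ⟨$⟩ʳ zero))

∑-permutations-1 : ∀ n → ∑[ π ∈ permutations n ] 1 ≡ n !
∑-permutations-1 zero    = refl
∑-permutations-1 (suc n) = begin
  ∑[ π ∈ permutations (suc n) ] 1                      ≡⟨ ∑-permutations-suc n (const 1) ⟩
  ∑[ j ∈ allFin (suc n) ] ∑[ π ∈ permutations n ] 1    ≡⟨ ∑-allFin-const (suc n) _ ⟩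
  suc n * (∑[ π ∈ permutations n ] 1)                  ≡⟨ cong (suc n *_) (∑-permutations-1 n) ⟩
  suc n !                                              ∎

-- Functions fixed by permutations

transpose-invariant : ∀ (g : Fin n → A) i j → g i ≡ g j → ∀ k → g (PC.transpose i j k) ≡ g k
transpose-invariant g i j gi≡gj k with k Fin.≟ i
... | yes refl = sym gi≡gj
... | no  _ with k Fin.≟ j
...   | yes refl = gi≡gj
...   | no  _    = refl

Fixes : (Fin n → Fin n) → (Fin n → Fin k) → Set
Fixes π f = f ≗ f ∘ π

fixes? : (π : Fin n → Fin n) (f : Fin n → Fin k) → Dec (Fixes π f)
fixes? π f = f ≗? (f ∘ π)

-- The rising factorial d(d+1)⋯(d+n-1).
rising : ℕ → ℕ → ℕ
rising d zero    = 1
rising d (suc n) = (d + n) * rising d n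

-- At `zero` the condition says that `zero` and `j` have the same colour. Once they do, the
-- transposition is invisible to the colouring, and what is left concerns `π` and `f` alone.
fixes-lift₀-transpose : ∀ c (f : Fin n → Fin k) (π : Permutation′ n) j →
  ⟦ fixes? (lift₀ π ∘ₚ transpose zero j ⟨$⟩ʳ_) (c Vector.∷ f) ⟧
    ≡ ⟦ c Fin.≟ (c Vector.∷ f) j ⟧ * ⟦ fixes? (π ⟨$⟩ʳ_) f ⟧
fixes-lift₀-transpose c f π j = trans
  (⟦⟧-cong (fixes? (lift₀ π ∘ₚ transpose zero j ⟨$⟩ʳ_) g) (c Fin.≟ g j ×-dec fixes? (π ⟨$⟩ʳ_) f)
    (λ e → e zero , λ i → trans (e (suc i)) (transpose-invariant g zero j (e zero) (suc (π ⟨$⟩ʳ i))))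
    (λ (c≡ , e) → λ { zero → c≡ ; (suc i) → trans (e i) (sym (transpose-invariant g zero j c≡ (suc (π ⟨$⟩ʳ i)))) }))
  (⟦⟧-× (c Fin.≟ g j) (fixes? (π ⟨$⟩ʳ_) f))
  where g = c Vector.∷ f

fixes-cong : ∀ (π : Fin n → Fin n) {f g : Fin n → Fin k} → f ≗ g → ⟦ fixes? π f ⟧ ≡ ⟦ fixes? π g ⟧
fixes-cong π {f} {g} f≗g = ⟦⟧-cong (fixes? π f) (fixes? π g)
  (λ e i → trans (sym (f≗g i)) (trans (e i) (f≗g (π i))))
  (λ e i → trans (f≗g i) (trans (e i) (sym (f≗g (π i)))))

-- Induction on the point `zero`. For `j = zero` it forms a cycle of its own and its colour is free,
-- which gives the factor `d`. For each of the `n` other `j` it is inserted into the cycle of `j`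
-- and its colour is forced.
∑-fixes : ∀ n d → ∑[ π ∈ permutations n ] ∑[ f ∈ functions n d ] ⟦ fixes? (π ⟨$⟩ʳ_) f ⟧ ≡ rising d n
∑-fixes zero    d = refl
∑-fixes (suc n) d = begin
  ∑[ π ∈ permutations (suc n) ] ∑[ f ∈ functions (suc n) d ] ⟦ fixes? (π ⟨$⟩ʳ_) f ⟧
    ≡⟨ ∑-permutations-suc n _ ⟩
  ∑[ j ∈ allFin (suc n) ] ∑[ π ∈ permutations n ] ∑[ f ∈ functions (suc n) d ]
    ⟦ fixes? (lift₀ π ∘ₚ transpose zero j ⟨$⟩ʳ_) f ⟧
    ≡⟨ ∑-cong (allFin (suc n)) (λ j → ∑-cong (permutations n) λ π → trans
         (∑-functions-suc n d _ (fixes-cong (lift₀ π ∘ₚ transpose zero j ⟨$⟩ʳ_)))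
         (∑-cong (allFin d) λ c → ∑-cong (functions n d) λ f → fixes-lift₀-transpose c f π j)) ⟩
  ∑[ j ∈ allFin (suc n) ] ∑[ π ∈ permutations n ] ∑[ c ∈ allFin d ] ∑[ f ∈ functions n d ] term j π c f
    ≡⟨ ∑-allFin-suc n _ ⟩
  (∑[ π ∈ permutations n ] ∑[ c ∈ allFin d ] ∑[ f ∈ functions n d ] term zero π c f) +
  (∑[ j ∈ allFin n ] ∑[ π ∈ permutations n ] ∑[ c ∈ allFin d ] ∑[ f ∈ functions n d ] term (suc j) π c f)
    ≡⟨ cong₂ _+_ (∑-cong (permutations n) zero-term)
         (∑-cong (allFin n) λ j → ∑-cong (permutations n) (suc-term j)) ⟩
  (∑[ π ∈ permutations n ] d * N π) + (∑[ j ∈ allFin n ] ∑[ π ∈ permutations n ] N π)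
    ≡⟨ cong₂ _+_ (∑-*ˡ (permutations n) d N) (∑-allFin-const n _) ⟩
  d * ∑ (permutations n) N + n * ∑ (permutations n) N
    ≡⟨ *-distribʳ-+ _ d n ⟨
  (d + n) * ∑ (permutations n) N
    ≡⟨ cong ((d + n) *_) (∑-fixes n d) ⟩
  rising d (suc n) ∎
  where
  term : Fin (suc n) → Permutation′ n → Fin d → (Fin n → Fin d) → ℕ
  term j π c f = ⟦ c Fin.≟ (c Vector.∷ f) j ⟧ * ⟦ fixes? (π ⟨$⟩ʳ_) f ⟧
  N : Permutation′ n → ℕ
  N π = ∑[ f ∈ functions n d ] ⟦ fixes? (π ⟨$⟩ʳ_) f ⟧
  zero-term : ∀ π → ∑[ c ∈ allFin d ] ∑[ f ∈ functions n d ] term zero π c f ≡ d * N π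
  zero-term π = trans
    (∑-cong (allFin d) λ c → ∑-cong (functions n d) λ f →
      trans (cong (_* ⟦ fixes? (π ⟨$⟩ʳ_) f ⟧) (⟦⟧-yes (c Fin.≟ c) refl)) (*-identityˡ _))
    (∑-allFin-const d (N π))
  suc-term : ∀ j π → ∑[ c ∈ allFin d ] ∑[ f ∈ functions n d ] term (suc j) π c f ≡ N π
  suc-term j π = trans (∑-swap (allFin d) (functions n d) _) (∑-cong (functions n d) λ f →
    trans (∑-*ʳ (allFin d) ⟦ fixes? (π ⟨$⟩ʳ_) f ⟧ _)
      (trans (cong (_* ⟦ fixes? (π ⟨$⟩ʳ_) f ⟧) (once (allFin-enumerates d) (f j))) (*-identityˡ _)))

-- Rising factorials and binomial coefficients

nCk-absorption : ∀ n k → suc k * (suc n C suc k) ≡ suc n * (n C k)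
nCk-absorption zero    zero    = refl
nCk-absorption zero    (suc k) = *-zeroʳ (2 + k)
nCk-absorption (suc n) zero    = begin
  1 * (suc (suc n) C 1)                    ≡⟨ cong (1 *_) (nCk+nC[k+1]≡[n+1]C[k+1] (suc n) 0) ⟨
  1 * (1 + suc n C 1)                      ≡⟨ cong suc (trans (+-identityʳ _) (trans (sym (+-identityʳ _)) (nCk-absorption n 0))) ⟩
  suc (suc n * 1)                          ∎
nCk-absorption (suc n) (suc k) = begin
  (2 + k) * ((2 + n) C (2 + k))
    ≡⟨ cong ((2 + k) *_) (nCk+nC[k+1]≡[n+1]C[k+1] (suc n) (suc k)) ⟨
  (2 + k) * (b + (suc n C (2 + k)))
    ≡⟨ split k b _ ⟩
  b + suc k * b + (2 + k) * (suc n C (2 + k))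
    ≡⟨ cong₂ (λ x y → b + x + y) (nCk-absorption n k) (nCk-absorption n (suc k)) ⟩
  b + suc n * (n C k) + suc n * (n C suc k)
    ≡⟨ merge n b (n C k) (n C suc k) ⟩
  b + suc n * (n C k + n C suc k)
    ≡⟨ cong (λ x → b + suc n * x) (nCk+nC[k+1]≡[n+1]C[k+1] n k) ⟩
  (2 + n) * b ∎
  where
  b = suc n C suc k
  split : ∀ k b c → (2 + k) * (b + c) ≡ b + suc k * b + (2 + k) * c
  split = solve-∀
  merge : ∀ n b c d → b + suc n * c + suc n * d ≡ b + suc n * (c + d)
  merge = solve-∀

rising≡!*C : ∀ d n → rising d n ≡ n ! * ((n + d ∸ 1) C n)
-- Truncation makes `n + d ∸ 1` equal to 0 here, and `0 C 0` is 1, the number of empty multisets.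
rising≡!*C zero    zero    = refl
rising≡!*C zero    (suc n) = begin
  n * rising 0 n              ≡⟨ n*rising≡0 n ⟩
  0                           ≡⟨ *-zeroʳ (suc n !) ⟨
  suc n ! * 0                 ≡⟨ cong (suc n ! *_) (k>n⇒nCk≡0 (ℕ.≤-reflexive (cong suc (+-identityʳ n)))) ⟨
  suc n ! * ((n + 0) C suc n) ∎
  where
  n*rising≡0 : ∀ n → n * rising 0 n ≡ 0
  n*rising≡0 zero    = refl
  n*rising≡0 (suc n) = trans (cong (suc n *_) (n*rising≡0 n)) (*-zeroʳ (suc n))
rising≡!*C (suc d) zero    = refl
rising≡!*C (suc d) (suc n) = begin
  suc (d + n) * rising (suc d) n              ≡⟨ cong (suc (d + n) *_) (rising≡!*C (suc d) n) ⟩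
  suc (d + n) * (n ! * ((n + suc d ∸ 1) C n)) ≡⟨ cong (λ x → suc (d + n) * (n ! * ((x ∸ 1) C n))) (ℕ.+-suc n d) ⟩
  suc (d + n) * (n ! * ((n + d) C n))         ≡⟨ cong (λ x → suc x * (n ! * ((n + d) C n))) (+-comm d n) ⟩
  suc (n + d) * (n ! * ((n + d) C n))         ≡⟨ rearrange (suc (n + d)) (n !) _ ⟩
  n ! * (suc (n + d) * ((n + d) C n))         ≡⟨ cong (n ! *_) (nCk-absorption (n + d) n) ⟨
  n ! * (suc n * (suc (n + d) C suc n))       ≡⟨ rearrange′ (n !) (suc n) _ ⟩
  suc n ! * (suc (n + d) C suc n)             ≡⟨ cong (λ x → suc n ! * (x C suc n)) (ℕ.+-suc n d) ⟨
  suc n ! * ((n + suc d) C suc n)             ∎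
  where
  rearrange : ∀ a b c → a * (b * c) ≡ b * (a * c)
  rearrange = solve-∀
  rearrange′ : ∀ a b c → a * (b * c) ≡ (b * a) * c
  rearrange′ = solve-∀

-- Burnside's lemma

module _ (Γ : Graph) {Λ μ : ℕ} where
  open Graph Γ

  proper-resp-≗ : {f g : Colouring Γ Λ} → f ≗ g → Proper Γ μ f → Proper Γ μ g
  proper-resp-≗ f≗g p v w vw rewrite sym (f≗g v) | sym (f≗g w) = p v w vw

  proper-∘ : {f : Colouring Γ Λ} {π : Permutation′ order} → IsAutomorphism Γ π →
             Proper Γ μ f → Proper Γ μ (f ∘ (π ⟨$⟩ʳ_))
  proper-∘ {π = π} aut p v w vw = p (π ⟨$⟩ʳ v) (π ⟨$⟩ʳ w) (Equivalence.to (aut v w) vw)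

#fixed : (Γ : Graph) (Λ μ : ℕ) → (Graph.Vertex Γ → Graph.Vertex Γ) → ℕ
#fixed Γ Λ μ π = ∑[ f ∈ functions (Graph.order Γ) Λ ] ⟦ proper? Γ μ f ⟧ * ⟦ fixes? π f ⟧

module _ (Γ : Graph) (G : AutSubgroup Γ) (Λ μ : ℕ) where
  open Graph Γ
  open AutSubgroup G

  equivalent-isEquivalence : IsEquivalence (Equivalent Γ G {Λ})
  equivalent-isEquivalence = record
    { refl  = Perm.id , id-closed , λ _ → refl
    ; sym   = λ {f} (g , g∈G , e) → Perm.flip g , flip-closed g∈G ,
                λ v → trans (cong f (sym (inverseʳ g))) (sym (e (g ⟨$⟩ˡ v)))
    ; trans = λ (g , g∈G , e) (h , h∈G , e′) → h ∘ₚ g , ∘-closed h∈G g∈G ,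
                λ v → trans (e′ v) (e (h ⟨$⟩ʳ v))
    }

  private
    |G| : ℕ
    |G| = ∑[ g ∈ permutations order ] ⟦ member? g ⟧

    stabiliser : Colouring Γ Λ → ℕ
    stabiliser f = ∑[ g ∈ permutations order ] ⟦ member? g ⟧ * ⟦ fixes? (g ⟨$⟩ʳ_) f ⟧

    transporter : Colouring Γ Λ → Colouring Γ Λ → ℕ
    transporter r f = ∑[ g ∈ permutations order ] ⟦ member? g ⟧ * ⟦ f ≗? (r ∘ (g ⟨$⟩ʳ_)) ⟧

  -- If `f` is `r` composed with a member `h`, then `g` fixes `f` exactly when `g ∘ₚ h` carries `r`
  -- to `f`, so translation by `h` matches the two sums. If there is no such `h`, both sides vanish.
  orbit-stabiliser : ∀ r f → ⟦ equivalent? Γ G r f ⟧ * stabiliser f ≡ transporter r f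
  orbit-stabiliser r f = ⟦⟧*-elim (equivalent? Γ G r f)
    (λ (h , h∈G , f≡rh) → ∑-reindex (permutationDecSetoid order) (permutationDecSetoid order)
      (permutations-enumerates order) (permutations-enumerates order)
      (_∘ₚ h) (_∘ₚ Perm.flip h) _ _
      (λ e i → sym (trans (cong (h ⟨$⟩ˡ_) (e i)) (inverseˡ h)))
      (λ e i → sym (trans (cong (h ⟨$⟩ʳ_) (e i)) (inverseʳ h)))
      λ {g} {g′} e → ⟦⟧*-cong (member? g) (member? g′)
        (λ g∈G → resp (λ i → sym (e i)) (∘-closed g∈G h∈G))
        (λ g′∈G → resp {g′ ∘ₚ Perm.flip h} {g}
                    (λ i → trans (cong (h ⟨$⟩ˡ_) (e i)) (inverseˡ h))
                    (∘-closed g′∈G (flip-closed h∈G)))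
        λ _ → ⟦⟧-cong (fixes? (g ⟨$⟩ʳ_) f) (f ≗? (r ∘ (g′ ⟨$⟩ʳ_)))
          (λ e′ v → trans (e′ v) (trans (f≡rh (g ⟨$⟩ʳ v)) (cong r (sym (e v)))))
          (λ e′ v → trans (e′ v) (trans (cong r (e v)) (sym (f≡rh (g ⟨$⟩ʳ v))))))
    λ f≁r → sym (trans (∑-cong (permutations order) λ g → trans (sym (⟦⟧-× (member? g) (f ≗? (r ∘ (g ⟨$⟩ʳ_)))))
      (⟦⟧-no (member? g ×-dec f ≗? (r ∘ (g ⟨$⟩ʳ_))) λ (g∈G , e) → f≁r (g , g∈G , e)))
    (∑-zero (permutations order)))

  -- Each member `g` carries `r` to exactly one colouring, which is proper because `g` is an
  -- automorphism.
  ∑-transporter : ∀ {r} → Proper Γ μ r →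
                  ∑[ f ∈ functions order Λ ] ⟦ proper? Γ μ f ⟧ * transporter r f ≡ |G|
  ∑-transporter {r} r-proper = begin
    ∑[ f ∈ functions order Λ ] ⟦ proper? Γ μ f ⟧ * transporter r f
      ≡⟨ ∑-cong (functions order Λ) (λ f → sym (∑-*ˡ (permutations order) ⟦ proper? Γ μ f ⟧ _)) ⟩
    ∑[ f ∈ functions order Λ ] ∑[ g ∈ permutations order ]
      ⟦ proper? Γ μ f ⟧ * (⟦ member? g ⟧ * ⟦ f ≗? (r ∘ (g ⟨$⟩ʳ_)) ⟧)
      ≡⟨ ∑-swap (functions order Λ) (permutations order) _ ⟩
    ∑[ g ∈ permutations order ] ∑[ f ∈ functions order Λ ]
      ⟦ proper? Γ μ f ⟧ * (⟦ member? g ⟧ * ⟦ f ≗? (r ∘ (g ⟨$⟩ʳ_)) ⟧)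
      ≡⟨ ∑-cong (permutations order) (λ g → trans
           (∑-cong (functions order Λ) λ f → rearrange ⟦ proper? Γ μ f ⟧ ⟦ member? g ⟧ _)
           (∑-single (functionDecSetoid order Λ) (functions-enumerates order Λ)
             (λ f → f ≗? (r ∘ (g ⟨$⟩ʳ_))) (r ∘ (g ⟨$⟩ʳ_))
             (λ f → ⟦ member? g ⟧ * ⟦ proper? Γ μ f ⟧) (λ e → e) (λ e → e)
             (λ {f} e → trans
               (⟦⟧*-cong (member? g) (member? g) (λ p → p) (λ p → p)
                 λ g∈G → ⟦⟧-yes (proper? Γ μ f)
                   (proper-resp-≗ Γ (λ v → sym (e v)) (proper-∘ Γ {π = g} (automorphism g∈G) r-proper)))
               (*-identityʳ _)))) ⟩
    |G| ∎
    where
    rearrange : ∀ a b c → a * (b * c) ≡ c * (b * a)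
    rearrange = solve-∀

  -- With every colouring weighted by the size of its stabiliser, each orbit has total weight `|G|`;
  -- orbit sizes and divisions do not appear. Exchanging the sums turns stabilisers into fixed
  -- colourings.
  burnside : #orbits Γ G Λ μ * |G| ≡
             ∑[ g ∈ permutations order ] ⟦ member? g ⟧ * #fixed Γ Λ μ (g ⟨$⟩ʳ_)
  burnside = begin
    #orbits Γ G Λ μ * |G|
      ≡⟨ #classes-* (equivalent? Γ G) equivalent-isEquivalence (properColourings Γ Λ μ) stabiliser |G|
           (λ {r} r∈ → begin
             ∑[ f ∈ properColourings Γ Λ μ ] ⟦ equivalent? Γ G r f ⟧ * stabiliser f
               ≡⟨ ∑-cong (properColourings Γ Λ μ) (orbit-stabiliser r) ⟩
             ∑ (properColourings Γ Λ μ) (transporter r)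
               ≡⟨ ∑-filter (proper? Γ μ) (functions order Λ) (transporter r) ⟩
             ∑[ f ∈ functions order Λ ] ⟦ proper? Γ μ f ⟧ * transporter r f
               ≡⟨ ∑-transporter (All.lookup (All.deduplicate⁺ (equivalent? Γ G)
                    (All.all-filter (proper? Γ μ) (functions order Λ))) r∈) ⟩
             |G| ∎) ⟩
    ∑ (properColourings Γ Λ μ) stabiliser
      ≡⟨ ∑-filter (proper? Γ μ) (functions order Λ) stabiliser ⟩
    ∑[ f ∈ functions order Λ ] ⟦ proper? Γ μ f ⟧ * stabiliser f
      ≡⟨ ∑-cong (functions order Λ) (λ f → sym (∑-*ˡ (permutations order) ⟦ proper? Γ μ f ⟧ _)) ⟩
    ∑[ f ∈ functions order Λ ] ∑[ g ∈ permutations order ]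
      ⟦ proper? Γ μ f ⟧ * (⟦ member? g ⟧ * ⟦ fixes? (g ⟨$⟩ʳ_) f ⟧)
      ≡⟨ ∑-swap (functions order Λ) (permutations order) _ ⟩
    ∑[ g ∈ permutations order ] ∑[ f ∈ functions order Λ ]
      ⟦ proper? Γ μ f ⟧ * (⟦ member? g ⟧ * ⟦ fixes? (g ⟨$⟩ʳ_) f ⟧)
      ≡⟨ ∑-cong (permutations order) (λ g → trans
           (∑-cong (functions order Λ) λ f → rearrange ⟦ proper? Γ μ f ⟧ ⟦ member? g ⟧ _)
           (∑-*ˡ (functions order Λ) ⟦ member? g ⟧ _)) ⟩
    ∑[ g ∈ permutations order ] ⟦ member? g ⟧ * #fixed Γ Λ μ (g ⟨$⟩ʳ_) ∎
    where
    rearrange : ∀ a b c → a * (b * c) ≡ b * (a * c)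
    rearrange = solve-∀

-- Automorphisms of complete bipartite graphs

+-elim : (Q : Fin (m + n) → Set) → (∀ i → Q (i ↑ˡ n)) → (∀ j → Q (m ↑ʳ j)) → ∀ v → Q v
+-elim {m} {n} Q l r v = subst Q (Fin.join-splitAt m n v) (go (splitAt m v))
  where
  go : ∀ s → Q (join m n s)
  go (inj₁ i) = l i
  go (inj₂ j) = r j

infixr 7 _⊞_ _⊕_

_⊞_ : ∀ {k l} → (Fin m → Fin k) → (Fin n → Fin l) → Fin (m + n) → Fin (k + l)
_⊞_ {k = k} {l} f g = ((_↑ˡ l) ∘ f) Vector.++ ((k ↑ʳ_) ∘ g)

module _ {k l} (f : Fin m → Fin k) (g : Fin n → Fin l) where

  ⊞-↑ˡ : ∀ i → (f ⊞ g) (i ↑ˡ n) ≡ f i ↑ˡ l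
  ⊞-↑ˡ = Vector.lookup-++ˡ ((_↑ˡ l) ∘ f) ((k ↑ʳ_) ∘ g)

  ⊞-↑ʳ : ∀ j → (f ⊞ g) (m ↑ʳ j) ≡ k ↑ʳ g j
  ⊞-↑ʳ = Vector.lookup-++ʳ ((_↑ˡ l) ∘ f) ((k ↑ʳ_) ∘ g)

⊞-inverse : ∀ {k l} (f : Fin m → Fin k) (g : Fin n → Fin l) (f′ : Fin k → Fin m) (g′ : Fin l → Fin n) →
            (∀ i → f′ (f i) ≡ i) → (∀ j → g′ (g j) ≡ j) → ∀ v → (f′ ⊞ g′) ((f ⊞ g) v) ≡ v
⊞-inverse {m} {n} f g f′ g′ f′f g′g = +-elim _
  (λ i → trans (cong (f′ ⊞ g′) (⊞-↑ˡ f g i)) (trans (⊞-↑ˡ f′ g′ (f i)) (cong (_↑ˡ n) (f′f i))))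
  (λ j → trans (cong (f′ ⊞ g′) (⊞-↑ʳ f g j)) (trans (⊞-↑ʳ f′ g′ (g j)) (cong (m ↑ʳ_) (g′g j))))

_⊕_ : Permutation′ m → Permutation′ n → Permutation′ (m + n)
σ ⊕ τ = permutation ((σ ⟨$⟩ʳ_) ⊞ (τ ⟨$⟩ʳ_)) ((σ ⟨$⟩ˡ_) ⊞ (τ ⟨$⟩ˡ_))
  (⊞-inverse (σ ⟨$⟩ˡ_) (τ ⟨$⟩ˡ_) (σ ⟨$⟩ʳ_) (τ ⟨$⟩ʳ_) (λ _ → inverseʳ σ) (λ _ → inverseʳ τ))
  (⊞-inverse (σ ⟨$⟩ʳ_) (τ ⟨$⟩ʳ_) (σ ⟨$⟩ˡ_) (τ ⟨$⟩ˡ_) (λ _ → inverseˡ σ) (λ _ → inverseˡ τ))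

swapHalves : ∀ n → Fin (n + n) → Fin (n + n)
swapHalves n = (n ↑ʳ_) Vector.++ (_↑ˡ n)

module _ (n : ℕ) where

  swapHalves-↑ˡ : ∀ i → swapHalves n (i ↑ˡ n) ≡ n ↑ʳ i
  swapHalves-↑ˡ = Vector.lookup-++ˡ (n ↑ʳ_) (_↑ˡ n)

  swapHalves-↑ʳ : ∀ i → swapHalves n (n ↑ʳ i) ≡ i ↑ˡ n
  swapHalves-↑ʳ = Vector.lookup-++ʳ (n ↑ʳ_) (_↑ˡ n)

  swapHalves-involutive : ∀ v → swapHalves n (swapHalves n v) ≡ v
  swapHalves-involutive = +-elim {n} {n} _
    (λ i → trans (cong (swapHalves n) (swapHalves-↑ˡ i)) (swapHalves-↑ʳ i))
    (λ i → trans (cong (swapHalves n) (swapHalves-↑ʳ i)) (swapHalves-↑ˡ i))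

  swapₚ : Permutation′ (n + n)
  swapₚ = permutation (swapHalves n) (swapHalves n) swapHalves-involutive swapHalves-involutive

-- Unfolds to the local definition of the parts in K, so that
-- part m n v ≢ part m n w is the adjacency relation of K m n.

part : ∀ m n → Fin (m + n) → Bool
part m n v = [ const false , const true ]′ (splitAt m v)

module _ (m n : ℕ) where

  part-↑ˡ : (i : Fin m) → part m n (i ↑ˡ n) ≡ false
  part-↑ˡ i = cong [ const false , const true ]′ (Fin.splitAt-↑ˡ m i n)

  part-↑ʳ : (j : Fin n) → part m n (m ↑ʳ j) ≡ true
  part-↑ʳ j = cong [ const false , const true ]′ (Fin.splitAt-↑ʳ m n j)

  part⁻¹-false : ∀ v → part m n v ≡ false → ∃[ i ] i ↑ˡ n ≡ v
  part⁻¹-false = +-elim {m} {n} _ (λ i _ → i , refl)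
    (λ j e → contradiction (trans (sym (part-↑ʳ j)) e) λ ())

  part⁻¹-true : ∀ v → part m n v ≡ true → ∃[ j ] m ↑ʳ j ≡ v
  part⁻¹-true = +-elim {m} {n} _ (λ i e → contradiction (trans (sym (part-↑ˡ i)) e) λ ()) (λ j _ → j , refl)

  PreservesParts ReversesParts : Pred (Permutation′ (m + n)) 0ℓ
  PreservesParts g = ∀ v → part m n (g ⟨$⟩ʳ v) ≡ part m n v
  ReversesParts  g = ∀ v → part m n (g ⟨$⟩ʳ v) ≡ not (part m n v)

  preservesParts? : Decidable PreservesParts
  preservesParts? g = all? λ v → part m n (g ⟨$⟩ʳ v) Bool.≟ part m n v

  reversesParts? : Decidable ReversesParts
  reversesParts? g = all? λ v → part m n (g ⟨$⟩ʳ v) Bool.≟ not (part m n v)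

  preservesParts⇒automorphism : ∀ g → PreservesParts g → IsAutomorphism (K m n) g
  preservesParts⇒automorphism g p v w = mk⇔
    (λ v≢w e → v≢w (trans (sym (p v)) (trans e (p w))))
    (λ v≢w e → v≢w (trans (p v) (trans e (sym (p w)))))

  reversesParts⇒automorphism : ∀ g → ReversesParts g → IsAutomorphism (K m n) g
  reversesParts⇒automorphism g r v w = mk⇔
    (λ v≢w e → v≢w (Bool.not-injective (trans (sym (r v)) (trans e (r w)))))
    (λ v≢w e → v≢w (trans (r v) (trans (cong not e) (sym (r w)))))

  -- The image of a vertex v₀ decides which, since every vertex lies in the part of v₀
  -- or is adjacent to v₀.

  automorphism⇒parts : Fin m → ∀ g → IsAutomorphism (K m n) g → PreservesParts g ⊎ ReversesParts g
  automorphism⇒parts i g aut = go (part m n (g ⟨$⟩ʳ v₀)) refl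
    where
    v₀ = i ↑ˡ n
    same : ∀ v → part m n v ≡ false → part m n (g ⟨$⟩ʳ v) ≡ part m n (g ⟨$⟩ʳ v₀)
    same v e = decidable-stable (_ Bool.≟ _) λ gv≢gv₀ →
      Equivalence.from (aut v v₀) gv≢gv₀ (trans e (sym (part-↑ˡ i)))
    different : ∀ v → part m n v ≡ true → part m n (g ⟨$⟩ʳ v) ≡ not (part m n (g ⟨$⟩ʳ v₀))
    different v e = Bool.¬-not (Equivalence.to (aut v v₀)
      λ e′ → contradiction (trans (sym e) (trans e′ (part-↑ˡ i))) λ ())
    go : ∀ b → part m n (g ⟨$⟩ʳ v₀) ≡ b → PreservesParts g ⊎ ReversesParts g
    go false e = inj₁ λ v → h v (part m n v) refl
      where
      h : ∀ v b → part m n v ≡ b → part m n (g ⟨$⟩ʳ v) ≡ part m n v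
      h v false p = trans (same v p) (trans e (sym p))
      h v true  p = trans (different v p) (trans (cong not e) (sym p))
    go true e = inj₂ λ v → h v (part m n v) refl
      where
      h : ∀ v b → part m n v ≡ b → part m n (g ⟨$⟩ʳ v) ≡ not (part m n v)
      h v false p = trans (same v p) (trans e (cong not (sym p)))
      h v true  p = trans (different v p) (trans (cong not e) (cong not (sym p)))

  -- `g` restricts to an injection of each part into the other.
  reversesParts⇒m≡n : ∀ g → ReversesParts g → m ≡ n
  reversesParts⇒m≡n g r = ℕ.≤-antisym
    (Fin.injective⇒≤ {f = λ i → proj₁ (left i)} λ {i} {i′} e →
      Fin.↑ˡ-injective n i i′ (g-injective (trans (sym (proj₂ (left i))) (trans (cong (m ↑ʳ_) e) (proj₂ (left i′))))))
    (Fin.injective⇒≤ {f = λ j → proj₁ (right j)} λ {j} {j′} e →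
      Fin.↑ʳ-injective m j j′ (g-injective (trans (sym (proj₂ (right j))) (trans (cong (_↑ˡ n) e) (proj₂ (right j′))))))
    where
    g-injective : ∀ {v w} → g ⟨$⟩ʳ v ≡ g ⟨$⟩ʳ w → v ≡ w
    g-injective e = trans (sym (inverseˡ g)) (trans (cong (g ⟨$⟩ˡ_) e) (inverseˡ g))
    left : ∀ i → ∃[ j ] m ↑ʳ j ≡ g ⟨$⟩ʳ (i ↑ˡ n)
    left i = part⁻¹-true _ (trans (r _) (cong not (part-↑ˡ i)))
    right : ∀ j → ∃[ i ] i ↑ˡ n ≡ g ⟨$⟩ʳ (m ↑ʳ j)
    right j = part⁻¹-false _ (trans (r _) (cong not (part-↑ʳ j)))

  ⊕-preservesParts : ∀ (σ : Permutation′ m) (τ : Permutation′ n) → PreservesParts (σ ⊕ τ)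
  ⊕-preservesParts σ τ = +-elim {m} {n} _
    (λ i → trans (cong (part m n) (⊞-↑ˡ (σ ⟨$⟩ʳ_) (τ ⟨$⟩ʳ_) i)) (trans (part-↑ˡ _) (sym (part-↑ˡ i))))
    (λ j → trans (cong (part m n) (⊞-↑ʳ (σ ⟨$⟩ʳ_) (τ ⟨$⟩ʳ_) j)) (trans (part-↑ʳ _) (sym (part-↑ʳ j))))

  ⊕-injective : ∀ (σ σ′ : Permutation′ m) (τ τ′ : Permutation′ n) → σ ⊕ τ Perm.≈ σ′ ⊕ τ′ →
                (σ Perm.≈ σ′) × (τ Perm.≈ τ′)
  ⊕-injective σ σ′ τ τ′ e =
    (λ i → Fin.↑ˡ-injective n _ _ (trans (sym (⊞-↑ˡ (σ ⟨$⟩ʳ_) (τ ⟨$⟩ʳ_) i))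
      (trans (e (i ↑ˡ n)) (⊞-↑ˡ (σ′ ⟨$⟩ʳ_) (τ′ ⟨$⟩ʳ_) i)))) ,
    (λ j → Fin.↑ʳ-injective m _ _ (trans (sym (⊞-↑ʳ (σ ⟨$⟩ʳ_) (τ ⟨$⟩ʳ_) j))
      (trans (e (m ↑ʳ j)) (⊞-↑ʳ (σ′ ⟨$⟩ʳ_) (τ′ ⟨$⟩ʳ_) j))))

  ⊕-cong : ∀ (σ σ′ : Permutation′ m) (τ τ′ : Permutation′ n) → σ Perm.≈ σ′ → τ Perm.≈ τ′ →
           σ ⊕ τ Perm.≈ σ′ ⊕ τ′
  ⊕-cong σ σ′ τ τ′ σ≈ τ≈ = +-elim {m} {n} _
    (λ i → trans (⊞-↑ˡ (σ ⟨$⟩ʳ_) (τ ⟨$⟩ʳ_) i) (trans (cong (_↑ˡ n) (σ≈ i)) (sym (⊞-↑ˡ (σ′ ⟨$⟩ʳ_) (τ′ ⟨$⟩ʳ_) i))))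
    (λ j → trans (⊞-↑ʳ (σ ⟨$⟩ʳ_) (τ ⟨$⟩ʳ_) j) (trans (cong (m ↑ʳ_) (τ≈ j)) (sym (⊞-↑ʳ (σ′ ⟨$⟩ʳ_) (τ′ ⟨$⟩ʳ_) j))))

  preservesParts⇒⊕ : ∀ g → PreservesParts g → ∃[ σ ] ∃[ τ ] g Perm.≈ σ ⊕ τ
  preservesParts⇒⊕ g p = σ , τ , +-elim {m} {n} _
    (λ i → trans (sym (proj₂ (left g p i))) (sym (⊞-↑ˡ (σ ⟨$⟩ʳ_) (τ ⟨$⟩ʳ_) i)))
    (λ j → trans (sym (proj₂ (right g p j))) (sym (⊞-↑ʳ (σ ⟨$⟩ʳ_) (τ ⟨$⟩ʳ_) j)))
    where
    -- Stated for an arbitrary part-preserving permutation because the inverses of `σ` and `τ` are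
    -- the restrictions of `g⁻¹`.
    left : ∀ g → PreservesParts g → ∀ i → ∃[ i′ ] i′ ↑ˡ n ≡ g ⟨$⟩ʳ (i ↑ˡ n)
    left g p i = part⁻¹-false _ (trans (p _) (part-↑ˡ i))
    right : ∀ g → PreservesParts g → ∀ j → ∃[ j′ ] m ↑ʳ j′ ≡ g ⟨$⟩ʳ (m ↑ʳ j)
    right g p j = part⁻¹-true _ (trans (p _) (part-↑ʳ j))
    leftInverse : ∀ g h (pg : PreservesParts g) (ph : PreservesParts h) → (∀ v → g ⟨$⟩ʳ (h ⟨$⟩ʳ v) ≡ v) →
                  ∀ i → proj₁ (left g pg (proj₁ (left h ph i))) ≡ i
    leftInverse g h pg ph gh i = Fin.↑ˡ-injective n _ _
      (trans (proj₂ (left g pg _)) (trans (cong (g ⟨$⟩ʳ_) (proj₂ (left h ph i))) (gh _)))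
    rightInverse : ∀ g h (pg : PreservesParts g) (ph : PreservesParts h) → (∀ v → g ⟨$⟩ʳ (h ⟨$⟩ʳ v) ≡ v) →
                   ∀ j → proj₁ (right g pg (proj₁ (right h ph j))) ≡ j
    rightInverse g h pg ph gh j = Fin.↑ʳ-injective m _ _
      (trans (proj₂ (right g pg _)) (trans (cong (g ⟨$⟩ʳ_) (proj₂ (right h ph j))) (gh _)))
    g⁻¹ = Perm.flip g
    p⁻¹ : PreservesParts g⁻¹
    p⁻¹ v = trans (sym (p _)) (cong (part m n) (inverseʳ g))
    σ = permutation (λ i → proj₁ (left g p i)) (λ i → proj₁ (left g⁻¹ p⁻¹ i))
      (leftInverse g g⁻¹ p p⁻¹ (λ _ → inverseʳ g)) (leftInverse g⁻¹ g p⁻¹ p (λ _ → inverseˡ g))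
    τ = permutation (λ j → proj₁ (right g p j)) (λ j → proj₁ (right g⁻¹ p⁻¹ j))
      (rightInverse g g⁻¹ p p⁻¹ (λ _ → inverseʳ g)) (rightInverse g⁻¹ g p⁻¹ p (λ _ → inverseˡ g))

  preservesParts-resp : ∀ g h → g Perm.≈ h → PreservesParts g → PreservesParts h
  preservesParts-resp g h g≈h p v = trans (cong (part m n) (sym (g≈h v))) (p v)

  -- The right side counts the decompositions of `g`, of which there is one or none. Reindexing by
  -- this count avoids an inverse of `_⊕_`, which would have to be defined on every permutation.
  preservesParts≡∑ : ∀ g → ⟦ preservesParts? g ⟧ ≡
    ∑[ σ ∈ permutations m ] ∑[ τ ∈ permutations n ] ⟦ (g ⟨$⟩ʳ_) ≗? (σ ⊕ τ ⟨$⟩ʳ_) ⟧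
  preservesParts≡∑ g = ⟦⟧-elim (preservesParts? g)
    (λ p → let σ , τ , g≈ = preservesParts⇒⊕ g p in sym (trans
    (sym (∑-cartesianProductWith (permutations m) (permutations n) _,_ _))
    (count-single (×-decSetoid (permutationDecSetoid m) (permutationDecSetoid n))
      (×-enumerates _ _ (permutations-enumerates m) (permutations-enumerates n))
      (λ (σ′ , τ′) → (g ⟨$⟩ʳ_) ≗? (σ′ ⊕ τ′ ⟨$⟩ʳ_)) (σ , τ)
      (λ {(σ′ , τ′)} e → ⊕-injective σ′ σ τ′ τ λ v → trans (sym (e v)) (g≈ v))
      (λ {(σ′ , τ′)} (σ≈ , τ≈) v → trans (g≈ v) (sym (⊕-cong σ′ σ τ′ τ σ≈ τ≈ v))))))
    λ ¬p → sym (trans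
    (∑-cong (permutations m) λ σ → trans
      (∑-cong (permutations n) λ τ → ⟦⟧-no ((g ⟨$⟩ʳ_) ≗? (σ ⊕ τ ⟨$⟩ʳ_)) λ e →
        ¬p (preservesParts-resp (σ ⊕ τ) g (λ v → sym (e v)) (⊕-preservesParts σ τ)))
      (∑-zero (permutations n)))
    (∑-zero (permutations m)))

  ∑-preservesParts : ∀ (F : Permutation′ (m + n) → ℕ) → (∀ {g h} → g Perm.≈ h → F g ≡ F h) →
    ∑[ g ∈ permutations (m + n) ] ⟦ preservesParts? g ⟧ * F g ≡
    ∑[ σ ∈ permutations m ] ∑[ τ ∈ permutations n ] F (σ ⊕ τ)
  ∑-preservesParts F F-cong = begin
    ∑[ g ∈ permutations (m + n) ] ⟦ preservesParts? g ⟧ * F g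
      ≡⟨ ∑-cong (permutations (m + n)) (λ g → begin
           ⟦ preservesParts? g ⟧ * F g
             ≡⟨ cong (_* F g) (preservesParts≡∑ g) ⟩
           (∑[ σ ∈ permutations m ] ∑[ τ ∈ permutations n ] ⟦ (g ⟨$⟩ʳ_) ≗? (σ ⊕ τ ⟨$⟩ʳ_) ⟧) * F g
             ≡⟨ ∑-*ʳ (permutations m) (F g) _ ⟨
           ∑[ σ ∈ permutations m ] (∑[ τ ∈ permutations n ] ⟦ (g ⟨$⟩ʳ_) ≗? (σ ⊕ τ ⟨$⟩ʳ_) ⟧) * F g
             ≡⟨ ∑-cong (permutations m) (λ σ → ∑-*ʳ (permutations n) (F g) _) ⟨
           ∑[ σ ∈ permutations m ] ∑[ τ ∈ permutations n ] ⟦ (g ⟨$⟩ʳ_) ≗? (σ ⊕ τ ⟨$⟩ʳ_) ⟧ * F g ∎) ⟩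
    ∑[ g ∈ permutations (m + n) ] ∑[ σ ∈ permutations m ] ∑[ τ ∈ permutations n ] term σ τ g
      ≡⟨ ∑-swap (permutations (m + n)) (permutations m) _ ⟩
    ∑[ σ ∈ permutations m ] ∑[ g ∈ permutations (m + n) ] ∑[ τ ∈ permutations n ] term σ τ g
      ≡⟨ ∑-cong (permutations m) (λ σ → ∑-swap (permutations (m + n)) (permutations n) _) ⟩
    ∑[ σ ∈ permutations m ] ∑[ τ ∈ permutations n ] ∑[ g ∈ permutations (m + n) ] term σ τ g
      ≡⟨ ∑-cong (permutations m) (λ σ → ∑-cong (permutations n) λ τ →
           ∑-single (permutationDecSetoid (m + n)) (permutations-enumerates (m + n))
             (λ g → (g ⟨$⟩ʳ_) ≗? (σ ⊕ τ ⟨$⟩ʳ_)) (σ ⊕ τ) F (λ e → e) (λ e → e)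
             λ {g} → F-cong {g} {σ ⊕ τ}) ⟩
    ∑[ σ ∈ permutations m ] ∑[ τ ∈ permutations n ] F (σ ⊕ τ) ∎
    where
    term : Permutation′ m → Permutation′ n → Permutation′ (m + n) → ℕ
    term σ τ g = ⟦ (g ⟨$⟩ʳ_) ≗? (σ ⊕ τ ⟨$⟩ʳ_) ⟧ * F g

swapHalves-reversesParts : ∀ n v → part n n (swapHalves n v) ≡ not (part n n v)
swapHalves-reversesParts n = +-elim {n} {n} _
  (λ i → trans (cong (part n n) (swapHalves-↑ˡ n i)) (trans (part-↑ʳ n n i) (cong not (sym (part-↑ˡ n n i)))))
  (λ i → trans (cong (part n n) (swapHalves-↑ʳ n i)) (trans (part-↑ˡ n n i) (cong not (sym (part-↑ʳ n n i)))))

-- Precomposition with the exchange of the halves is an involution that interchanges reversing and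
-- preserving the parts.
∑-reversesParts : ∀ n (F : Permutation′ (n + n) → ℕ) → (∀ {g h} → g Perm.≈ h → F g ≡ F h) →
  ∑[ g ∈ permutations (n + n) ] ⟦ reversesParts? n n g ⟧ * F g ≡
  ∑[ σ ∈ permutations n ] ∑[ τ ∈ permutations n ] F (swapₚ n ∘ₚ (σ ⊕ τ))
∑-reversesParts n F F-cong = trans
  (∑-transfer (permutationDecSetoid (n + n)) (permutationDecSetoid (n + n))
    (permutations-enumerates (n + n)) (permutations-enumerates (n + n))
    (reversesParts? n n) (preservesParts? n n) (swapₚ n ∘ₚ_) (swapₚ n ∘ₚ_)
    F (λ g → F (swapₚ n ∘ₚ g))
    (λ {g} {h} r e →
      (λ v → trans (cong (part n n) (e v)) (trans (r _)
        (trans (cong not (swapHalves-reversesParts n v)) (Bool.not-involutive _)))) ,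
      λ v → trans (cong (g ⟨$⟩ʳ_) (sym (swapHalves-involutive n v))) (sym (e _)))
    (λ {g} {h} p e →
      (λ v → trans (cong (part n n) (e v)) (trans (p _) (swapHalves-reversesParts n v))) ,
      λ v → trans (cong (h ⟨$⟩ʳ_) (sym (swapHalves-involutive n v))) (sym (e _)))
    λ {g} {h} _ e → F-cong {g} {swapₚ n ∘ₚ h}
      λ v → trans (cong (g ⟨$⟩ʳ_) (sym (swapHalves-involutive n v))) (sym (e _)))
  (∑-preservesParts n n (λ g → F (swapₚ n ∘ₚ g)) λ {g} {h} e → F-cong {swapₚ n ∘ₚ g} {swapₚ n ∘ₚ h} (λ v → e _))

∑-Aut-≢ : ∀ {m n} → .{{NonZero m}} → m ≢ n → (F : Permutation′ (m + n) → ℕ) → (∀ {g h} → g Perm.≈ h → F g ≡ F h) →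
  ∑[ g ∈ permutations (m + n) ] ⟦ isAutomorphism? (K m n) g ⟧ * F g ≡
  ∑[ σ ∈ permutations m ] ∑[ τ ∈ permutations n ] F (σ ⊕ τ)
∑-Aut-≢ {m@(suc _)} {n} m≢n F F-cong = trans
  (∑-cong (permutations (m + n)) λ g → ⟦⟧*-cong (isAutomorphism? (K m n) g) (preservesParts? m n g)
    (λ aut → [ (λ p → p) , (λ r → contradiction (reversesParts⇒m≡n m n g r) m≢n) ]′
      (automorphism⇒parts m n zero g aut))
    (preservesParts⇒automorphism m n g) (λ _ → refl))
  (∑-preservesParts m n F (λ {g} {h} → F-cong {g} {h}))

∑-Aut-≡ : ∀ {n} → .{{NonZero n}} → (F : Permutation′ (n + n) → ℕ) → (∀ {g h} → g Perm.≈ h → F g ≡ F h) →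
  ∑[ g ∈ permutations (n + n) ] ⟦ isAutomorphism? (K n n) g ⟧ * F g ≡
  (∑[ σ ∈ permutations n ] ∑[ τ ∈ permutations n ] F (σ ⊕ τ)) +
  (∑[ σ ∈ permutations n ] ∑[ τ ∈ permutations n ] F (swapₚ n ∘ₚ (σ ⊕ τ)))
∑-Aut-≡ {n@(suc n-1)} F F-cong = begin
  ∑[ g ∈ permutations (n + n) ] ⟦ isAutomorphism? (K n n) g ⟧ * F g
    ≡⟨ ∑-cong (permutations (n + n)) (λ g → trans (cong (_* F g) (split g)) (*-distribʳ-+ (F g) ⟦ preservesParts? n n g ⟧ _)) ⟩
  ∑[ g ∈ permutations (n + n) ] ⟦ preservesParts? n n g ⟧ * F g + ⟦ reversesParts? n n g ⟧ * F g
    ≡⟨ ∑-+ (permutations (n + n)) _ _ ⟩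
  (∑[ g ∈ permutations (n + n) ] ⟦ preservesParts? n n g ⟧ * F g) +
  (∑[ g ∈ permutations (n + n) ] ⟦ reversesParts? n n g ⟧ * F g)
    ≡⟨ cong₂ _+_ (∑-preservesParts n n F (λ {g} {h} → F-cong {g} {h})) (∑-reversesParts n F (λ {g} {h} → F-cong {g} {h})) ⟩
  (∑[ σ ∈ permutations n ] ∑[ τ ∈ permutations n ] F (σ ⊕ τ)) +
  (∑[ σ ∈ permutations n ] ∑[ τ ∈ permutations n ] F (swapₚ n ∘ₚ (σ ⊕ τ))) ∎
  where
  split : ∀ g → ⟦ isAutomorphism? (K n n) g ⟧ ≡ ⟦ preservesParts? n n g ⟧ + ⟦ reversesParts? n n g ⟧
  split g = go (isAutomorphism? (K n n) g) (preservesParts? n n g) (reversesParts? n n g)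
    where
    go : (a : Dec (IsAutomorphism (K n n) g)) (p : Dec (PreservesParts n n g)) (r : Dec (ReversesParts n n g)) →
         ⟦ a ⟧ ≡ ⟦ p ⟧ + ⟦ r ⟧
    -- Here `n` has to be nonzero: on the empty graph a permutation vacuously preserves and reverses
    -- the parts.
    go _       (yes p) (yes r) = contradiction (trans (sym (p zero)) (r zero)) (Bool.not-¬ refl)
    go (yes _) (yes _) (no _)  = refl
    go (yes _) (no _)  (yes _) = refl
    go (yes a) (no ¬p) (no ¬r) = contradiction (automorphism⇒parts n n zero g a) [ ¬p , ¬r ]′
    go (no ¬a) (yes p) _       = contradiction (preservesParts⇒automorphism n n g p) ¬a
    go (no ¬a) _       (yes r) = contradiction (reversesParts⇒automorphism n n g r) ¬a
    go (no _)  (no _)  (no _)  = refl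

-- Colourings of complete bipartite graphs fixed by an automorphism

Compatible : ∀ {Λ} → ℕ → Fin Λ → Fin Λ → Set
Compatible μ c c′ = c ≢ c′ ⊎ (c ≡ c′ × μ < suc (toℕ c))

Compatible-sym : ∀ {Λ μ} {c c′ : Fin Λ} → Compatible μ c c′ → Compatible μ c′ c
Compatible-sym (inj₁ c≢c′)         = inj₁ (c≢c′ ∘ sym)
Compatible-sym (inj₂ (refl , μ<c)) = inj₂ (refl , μ<c)

module _ (m n : ℕ) {Λ μ : ℕ} {f : Fin (m + n) → Fin Λ} where

  proper⇒compatible : Proper (K m n) μ f → ∀ i j → Compatible μ (f (i ↑ˡ n)) (f (m ↑ʳ j))
  proper⇒compatible p i j = p (i ↑ˡ n) (m ↑ʳ j)
    λ e → contradiction (trans (sym (part-↑ˡ m n i)) (trans e (part-↑ʳ m n j))) λ ()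

  compatible⇒proper : (∀ i j → Compatible μ (f (i ↑ˡ n)) (f (m ↑ʳ j))) → Proper (K m n) μ f
  compatible⇒proper h = +-elim {m} {n} _
    (λ i → +-elim {m} {n} _
      (λ i′ ≢ₚ → contradiction (trans (part-↑ˡ m n i) (sym (part-↑ˡ m n i′))) ≢ₚ)
      (λ j _ → h i j))
    (λ j → +-elim {m} {n} _
      (λ i _ → Compatible-sym (h i j))
      (λ j′ ≢ₚ → contradiction (trans (part-↑ʳ m n j) (sym (part-↑ʳ m n j′))) ≢ₚ))

-- `a ⊞ b` respects the parts and hence adjacency, whatever `a` and `b` are. It therefore serves
-- both for the projection to cycles and for the choice of representatives.
proper-⊞ : ∀ {k l Λ μ} {f : Fin (k + l) → Fin Λ} (a : Fin m → Fin k) (b : Fin n → Fin l) →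
           Proper (K k l) μ f → Proper (K m n) μ (f ∘ (a ⊞ b))
proper-⊞ {m} {n} {k} {l} {μ = μ} {f} a b p = compatible⇒proper m n λ i j →
  subst (λ v → Compatible μ (f v) (f ((a ⊞ b) (m ↑ʳ j)))) (sym (⊞-↑ˡ a b i))
    (subst (λ w → Compatible μ (f (a i ↑ˡ l)) (f w)) (sym (⊞-↑ʳ a b j))
      (proper⇒compatible k l p (a i) (b j)))

#proper≡∑ : ∀ Γ Λ μ → #proper Γ Λ μ ≡ ∑[ f ∈ functions (Graph.order Γ) Λ ] ⟦ proper? Γ μ f ⟧
#proper≡∑ Γ Λ μ = length-filter≡∑ (proper? Γ μ) (functions (Graph.order Γ) Λ)

-- Quotients of finite sets and the cycles of a permutation

module _ {Q : Pred A 0ℓ} (Q? : Decidable Q) where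

  count-none : ∀ xs → ∑[ x ∈ xs ] ⟦ Q? x ⟧ ≡ 0 → ∀ i → ¬ Q (lookup xs i)
  count-none (x ∷ xs) e i q with Q? x
  count-none (x ∷ xs) e zero    q | no ¬q = ¬q q
  count-none (x ∷ xs) e (suc i) q | no ¬q = count-none xs e i q

  -- The witness is a position and not an element, since positions in the list of representatives
  -- serve as names of the classes.
  count-unique : ∀ xs → ∑[ x ∈ xs ] ⟦ Q? x ⟧ ≡ 1 →
                 ∃[ i ] Q (lookup xs i) × (∀ j → Q (lookup xs j) → j ≡ i)
  count-unique (x ∷ xs) e with Q? x
  ... | yes q = zero , q , λ
    { zero    _  → refl
    ; (suc j) q′ → contradiction q′ (count-none xs (ℕ.suc-injective e) j)
    }
  ... | no ¬q with i , q , unique ← count-unique xs e = suc i , q , λ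
    { zero    q′ → contradiction q′ ¬q
    ; (suc j) q′ → cong suc (unique j q′)
    }

-- The quotient is realised as `Fin` of the length of the deduplicated list, so for cycles its size
-- is `#cycles` by definition and colourings of the quotient are colourings of a graph `K`.
module Quotient {R : Fin n → Fin n → Set} (R? : Decidable₂ R) (isEq : IsEquivalence R) where
  private module R = IsEquivalence isEq

  size : ℕ
  size = #classes R? (allFin n)

  rep : Fin size → Fin n
  rep = lookup (deduplicate R? (allFin n))

  private
    unique-rep : ∀ i → ∃[ c ] R (rep c) i × (∀ c′ → R (rep c′) i → c′ ≡ c)
    unique-rep i = count-unique (λ r → R? r i) (deduplicate R? (allFin n))
      (∑-representatives R? isEq (allFin n) (∈-allFin i))

  class : Fin n → Fin size
  class i = proj₁ (unique-rep i)

  rep-class : ∀ i → R (rep (class i)) i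
  rep-class i = proj₁ (proj₂ (unique-rep i))

  class-rep : ∀ c → class (rep c) ≡ c
  class-rep c = sym (proj₂ (proj₂ (unique-rep (rep c))) c R.refl)

  class-cong : ∀ {i j} → R i j → class i ≡ class j
  class-cong {i} {j} iRj = proj₂ (proj₂ (unique-rep j)) (class i) (R.trans (rep-class i) iRj)

  size≤n : size ≤ n
  size≤n = Fin.injective⇒≤ {f = rep} λ {c} {c′} e →
    trans (sym (class-rep c)) (trans (cong class e) (class-rep c′))

iterate-+ : ∀ (f : A → A) x m n → iterate f x (m + n) ≡ iterate f (iterate f x m) n
iterate-+ f x zero    n = refl
iterate-+ f x (suc m) n = iterate-+ f (f x) m n

iterate-invariant : ∀ (f : A → A) (g : A → B) → (∀ x → g x ≡ g (f x)) → ∀ x n → g (iterate f x n) ≡ g x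
iterate-invariant f g h x zero    = refl
iterate-invariant f g h x (suc n) = trans (iterate-invariant f g h (f x) n) (sym (h x))

iterate-injective : ∀ (f : A → A) → (∀ {x y} → f x ≡ f y → x ≡ y) →
                    ∀ {x y} n → iterate f x n ≡ iterate f y n → x ≡ y
iterate-injective f inj zero    e = e
iterate-injective f inj (suc n) e = inj (iterate-injective f inj n e)

iterate-* : ∀ (f : A → A) {x} p → iterate f x p ≡ x → ∀ q → iterate f x (q * p) ≡ x
iterate-* f p e zero    = refl
iterate-* f {x} p e (suc q) = trans (iterate-+ f x p (q * p))
  (trans (cong (λ y → iterate f y (q * p)) e) (iterate-* f p e q))

module _ (π : Permutation′ n) where
  private
    it : Fin n → ℕ → Fin n
    it = iterate (π ⟨$⟩ʳ_)

  -- Among the `n + 1` iterates with exponents 0 to `n` two coincide by the pigeonhole principle,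
  -- and injectivity cancels the shorter run. The bound by `n` is what brings exponents into the
  -- range used by `SameCycle`.
  period : ∀ i → ∃[ p ] suc p ≤ n × it i (suc p) ≡ i
  period i with a , b , a<b , e ← Fin.pigeonhole (ℕ.n<1+n n) (λ (e : Fin (suc n)) → it i (toℕ e))
           with d , 1+a+d≡b ← ℕ.m≤n⇒∃[o]m+o≡n a<b = d , d<n , iterate-injective (π ⟨$⟩ʳ_) π-injective (toℕ a) (begin
    it (it i (suc d)) (toℕ a) ≡⟨ iterate-+ (π ⟨$⟩ʳ_) i (suc d) (toℕ a) ⟨
    it i (suc d + toℕ a)      ≡⟨ cong (it i) (trans (cong suc (+-comm d (toℕ a))) 1+a+d≡b) ⟩
    it i (toℕ b)              ≡⟨ e ⟨
    it i (toℕ a)              ∎)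
    where
    π-injective : ∀ {x y} → π ⟨$⟩ʳ x ≡ π ⟨$⟩ʳ y → x ≡ y
    π-injective e = trans (sym (inverseˡ π)) (trans (cong (π ⟨$⟩ˡ_) e) (inverseˡ π))
    d<n : suc d ≤ n
    d<n = ℕ.≤-trans (s≤s (ℕ.m≤n+m d (toℕ a))) (ℕ.≤-trans (ℕ.≤-reflexive 1+a+d≡b) (Fin.toℕ≤pred[n] b))

  -- The exponent is reduced modulo the period. Afterwards exponents may be added and multiplied
  -- freely in the proof of equivalence.
  iterate⇒sameCycle : ∀ {i j} e → it i e ≡ j → SameCycle π i j
  iterate⇒sameCycle {i} {j} e h with p , p<n , returns ← period i =
    fromℕ< r<n , (begin
      it i (toℕ (fromℕ< r<n))                    ≡⟨ cong (it i) (Fin.toℕ-fromℕ< r<n) ⟩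
      it i (e % suc p)                           ≡⟨ cong (λ x → it x (e % suc p)) (iterate-* (π ⟨$⟩ʳ_) (suc p) returns (e ℕ./ suc p)) ⟨
      it (it i (e ℕ./ suc p * suc p)) (e % suc p)  ≡⟨ iterate-+ (π ⟨$⟩ʳ_) i (e ℕ./ suc p * suc p) (e % suc p) ⟨
      it i (e ℕ./ suc p * suc p + e % suc p)       ≡⟨ cong (it i) (+-comm (e ℕ./ suc p * suc p) (e % suc p)) ⟩
      it i (e % suc p + e ℕ./ suc p * suc p)       ≡⟨ cong (it i) (m≡m%n+[m/n]*n e (suc p)) ⟨
      it i e                                     ≡⟨ h ⟩
      j                                          ∎)
    where
    r<n : e % suc p < n
    r<n = ℕ.<-≤-trans (m%n<n e (suc p)) p<n

  sameCycle-isEquivalence : IsEquivalence (SameCycle π)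
  sameCycle-isEquivalence = record
    { refl  = iterate⇒sameCycle 0 refl
    -- Inverses are avoided: `e * p` further steps bring the total to `e * suc p`, a multiple of the
    -- period.
    ; sym   = λ {i} {j} (e , h) → let p , _ , returns = period i in
        iterate⇒sameCycle (toℕ e * p) (begin
          it j (toℕ e * p)              ≡⟨ cong (λ x → it x (toℕ e * p)) h ⟨
          it (it i (toℕ e)) (toℕ e * p) ≡⟨ iterate-+ (π ⟨$⟩ʳ_) i (toℕ e) (toℕ e * p) ⟨
          it i (toℕ e + toℕ e * p)      ≡⟨ cong (it i) (ℕ.*-suc (toℕ e) p) ⟨
          it i (toℕ e * suc p)          ≡⟨ iterate-* (π ⟨$⟩ʳ_) (suc p) returns (toℕ e) ⟩
          i                             ∎)
    ; trans = λ {i} {j} {k} (e , h) (e′ , h′) → iterate⇒sameCycle (toℕ e + toℕ e′)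
        (trans (iterate-+ (π ⟨$⟩ʳ_) i (toℕ e) (toℕ e′)) (trans (cong (λ x → it x (toℕ e′)) h) h′))
    }

  module Cycles = Quotient (sameCycle? π) sameCycle-isEquivalence

  class-step : ∀ i → Cycles.class (π ⟨$⟩ʳ i) ≡ Cycles.class i
  class-step i = sym (Cycles.class-cong (iterate⇒sameCycle 1 refl))

  fixes⇒rep-class : ∀ {f : Fin n → A} → f ≗ f ∘ (π ⟨$⟩ʳ_) → ∀ i → f (Cycles.rep (Cycles.class i)) ≡ f i
  fixes⇒rep-class {f = f} h i with e , s ← Cycles.rep-class i = sym (trans (cong f (sym s))
    (iterate-invariant (π ⟨$⟩ʳ_) f h (Cycles.rep (Cycles.class i)) (toℕ e)))

-- Cycles are taken in each part separately, so that the quotient is again a complete bipartite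
-- graph. Composition with `class` and composition with `rep` are inverse to each other because a
-- fixed colouring is constant on cycles.
#fixed-⊕ : ∀ {m n} Λ μ (σ : Permutation′ m) (τ : Permutation′ n) →
           #fixed (K m n) Λ μ (σ ⊕ τ ⟨$⟩ʳ_) ≡ #proper (K (#cycles σ) (#cycles τ)) Λ μ
#fixed-⊕ {m} {n} Λ μ σ τ = begin
  ∑[ f ∈ functions (m + n) Λ ] ⟦ proper? (K m n) μ f ⟧ * ⟦ fixes? (σ ⊕ τ ⟨$⟩ʳ_) f ⟧
    ≡⟨ ∑-cong (functions (m + n) Λ) (λ f → ⟦⟧-× (proper? (K m n) μ f) (fixes? (σ ⊕ τ ⟨$⟩ʳ_) f)) ⟨
  ∑[ f ∈ functions (m + n) Λ ] ⟦ proper? (K m n) μ f ×-dec fixes? (σ ⊕ τ ⟨$⟩ʳ_) f ⟧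
    ≡⟨ count-transfer (functionDecSetoid (m + n) Λ) (functionDecSetoid (#cycles σ + #cycles τ) Λ)
         (functions-enumerates (m + n) Λ) (functions-enumerates (#cycles σ + #cycles τ) Λ)
         (λ f → proper? (K m n) μ f ×-dec fixes? (σ ⊕ τ ⟨$⟩ʳ_) f) (proper? (K (#cycles σ) (#cycles τ)) μ)
         (_∘ rep) (_∘ class)
         (λ {f} {h} (p , fix) h≗ →
           proper-resp-≗ (K (#cycles σ) (#cycles τ)) (λ c → sym (h≗ c)) (proper-⊞ {f = f} στ.rep ττ.rep p) ,
           λ v → sym (trans (h≗ (class v)) (rep-class fix v)))
         (λ {f} {h} p f≗ →
           (proper-resp-≗ (K m n) (λ v → sym (f≗ v)) (proper-⊞ {f = h} στ.class ττ.class p) ,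
            λ v → trans (f≗ v) (trans (cong h (sym (step v))) (sym (f≗ _)))) ,
           λ c → sym (trans (f≗ (rep c)) (cong h (⊞-inverse στ.rep ττ.rep στ.class ττ.class στ.class-rep ττ.class-rep c)))) ⟩
  ∑[ h ∈ functions (#cycles σ + #cycles τ) Λ ] ⟦ proper? (K (#cycles σ) (#cycles τ)) μ h ⟧
    ≡⟨ #proper≡∑ (K (#cycles σ) (#cycles τ)) Λ μ ⟨
  #proper (K (#cycles σ) (#cycles τ)) Λ μ ∎
  where
  module στ = Cycles σ
  module ττ = Cycles τ
  rep : Fin (#cycles σ + #cycles τ) → Fin (m + n)
  rep = στ.rep ⊞ ττ.rep
  class : Fin (m + n) → Fin (#cycles σ + #cycles τ)
  class = στ.class ⊞ ττ.class
  step : ∀ v → class (σ ⊕ τ ⟨$⟩ʳ v) ≡ class v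
  step = +-elim {m} {n} _
    (λ i → trans (cong class (⊞-↑ˡ (σ ⟨$⟩ʳ_) (τ ⟨$⟩ʳ_) i)) (trans (⊞-↑ˡ στ.class ττ.class (σ ⟨$⟩ʳ i))
      (trans (cong (_↑ˡ #cycles τ) (class-step σ i)) (sym (⊞-↑ˡ στ.class ττ.class i)))))
    (λ j → trans (cong class (⊞-↑ʳ (σ ⟨$⟩ʳ_) (τ ⟨$⟩ʳ_) j)) (trans (⊞-↑ʳ στ.class ττ.class (τ ⟨$⟩ʳ j))
      (trans (cong (#cycles σ ↑ʳ_) (class-step τ j)) (sym (⊞-↑ʳ στ.class ττ.class j)))))
  rep-class : ∀ {f : Fin (m + n) → Fin Λ} → Fixes (σ ⊕ τ ⟨$⟩ʳ_) f → ∀ v → f (rep (class v)) ≡ f v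
  rep-class {f} fix = +-elim {m} {n} _
    (λ i → trans (cong (f ∘ rep) (⊞-↑ˡ στ.class ττ.class i)) (trans (cong f (⊞-↑ˡ στ.rep ττ.rep (στ.class i)))
      (fixes⇒rep-class σ {f = f ∘ (_↑ˡ n)} (λ i′ → trans (fix (i′ ↑ˡ n)) (cong f (⊞-↑ˡ (σ ⟨$⟩ʳ_) (τ ⟨$⟩ʳ_) i′))) i)))
    (λ j → trans (cong (f ∘ rep) (⊞-↑ʳ στ.class ττ.class j)) (trans (cong f (⊞-↑ʳ στ.rep ττ.rep (ττ.class j)))
      (fixes⇒rep-class τ {f = f ∘ (m ↑ʳ_)} (λ j′ → trans (fix (m ↑ʳ j′)) (cong f (⊞-↑ʳ (σ ⟨$⟩ʳ_) (τ ⟨$⟩ʳ_) j′))) j)))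

-- A proper colouring fixed by an automorphism exchanging the two parts takes equal values on
-- adjacent vertices, hence uses only colours above μ, and its restriction to either part determines it.

large-colour : ∀ {μ d} (c : Fin (μ + d)) → μ < suc (toℕ c) → ∃[ e ] μ ↑ʳ e ≡ c
large-colour {μ} {d} = +-elim {μ} {d} _
  (λ c μ≤c → contradiction (subst (μ ≤_) (Fin.toℕ-↑ˡ c d) (ℕ.≤-pred μ≤c)) (ℕ.<⇒≱ (Fin.toℕ<n c)))
  (λ e _ → e , refl)

↑ʳ-large : ∀ {μ d} (e : Fin d) → μ < suc (toℕ (μ ↑ʳ e))
↑ʳ-large {μ} e = s≤s (subst (μ ≤_) (sym (Fin.toℕ-↑ʳ μ e)) (ℕ.m≤m+n μ (toℕ e)))

module _ {n} (μ d : ℕ) (σ τ : Permutation′ n) where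
  private
    g : Fin (n + n) → Fin (n + n)
    g = swapₚ n ∘ₚ (σ ⊕ τ) ⟨$⟩ʳ_

    g-↑ˡ : ∀ i → g (i ↑ˡ n) ≡ n ↑ʳ (τ ⟨$⟩ʳ i)
    g-↑ˡ i = trans (cong (σ ⊕ τ ⟨$⟩ʳ_) (swapHalves-↑ˡ n i)) (⊞-↑ʳ (σ ⟨$⟩ʳ_) (τ ⟨$⟩ʳ_) i)

    g-↑ʳ : ∀ i → g (n ↑ʳ i) ≡ (σ ⟨$⟩ʳ i) ↑ˡ n
    g-↑ʳ i = trans (cong (σ ⊕ τ ⟨$⟩ʳ_) (swapHalves-↑ʳ n i)) (⊞-↑ˡ (σ ⟨$⟩ʳ_) (τ ⟨$⟩ʳ_) i)

    -- The right half is forced: `g` sends `n ↑ʳ i` to `(σ ⟨$⟩ʳ i) ↑ˡ n`, and a fixed colouring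
    -- agrees on the two. The condition at the left vertices then becomes invariance of `h` under
    -- `στ`.
    extend : (Fin n → Fin d) → Fin (n + n) → Fin (μ + d)
    extend h = ((μ ↑ʳ_) ∘ h) Vector.++ ((μ ↑ʳ_) ∘ h ∘ (σ ⟨$⟩ʳ_))

    extend-↑ˡ : ∀ h i → extend h (i ↑ˡ n) ≡ μ ↑ʳ h i
    extend-↑ˡ h = Vector.lookup-++ˡ ((μ ↑ʳ_) ∘ h) ((μ ↑ʳ_) ∘ h ∘ (σ ⟨$⟩ʳ_))

    extend-↑ʳ : ∀ h i → extend h (n ↑ʳ i) ≡ μ ↑ʳ h (σ ⟨$⟩ʳ i)
    extend-↑ʳ h = Vector.lookup-++ʳ ((μ ↑ʳ_) ∘ h) ((μ ↑ʳ_) ∘ h ∘ (σ ⟨$⟩ʳ_))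

    στ : Fin n → Fin n
    στ = τ ∘ₚ σ ⟨$⟩ʳ_

    extend-proper : ∀ h → Proper (K n n) μ (extend h)
    extend-proper h = compatible⇒proper n n {f = extend h} compatible
      where
      compatible : ∀ i j → Compatible μ (extend h (i ↑ˡ n)) (extend h (n ↑ʳ j))
      compatible i j with extend h (i ↑ˡ n) Fin.≟ extend h (n ↑ʳ j)
      ... | yes e = inj₂ (e , subst (λ c → μ < suc (toℕ c)) (sym (extend-↑ˡ h i)) (↑ʳ-large (h i)))
      ... | no ≢ₕ = inj₁ ≢ₕ

    extend-fixed : ∀ h → Fixes στ h → Fixes g (extend h)
    extend-fixed h fix = +-elim {n} {n} _
      (λ i → trans (extend-↑ˡ h i) (trans (cong (μ ↑ʳ_) (fix i))
        (sym (trans (cong (extend h) (g-↑ˡ i)) (extend-↑ʳ h (τ ⟨$⟩ʳ i))))))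
      (λ i → trans (extend-↑ʳ h i) (sym (trans (cong (extend h) (g-↑ʳ i)) (extend-↑ˡ h (σ ⟨$⟩ʳ i)))))

    restrict : ∀ (f : Fin (n + n) → Fin (μ + d)) → Proper (K n n) μ f → Fixes g f → ∃[ h ] Fixes στ h × f ≗ extend h
    restrict f p fix = h , h-fixed , +-elim {n} {n} _
      (λ i → trans (sym (h-spec i)) (sym (extend-↑ˡ h i)))
      (λ i → trans (fix _) (trans (cong f (g-↑ʳ i)) (trans (sym (h-spec (σ ⟨$⟩ʳ i))) (sym (extend-↑ʳ h i)))))
      where
      large : ∀ i → ∃[ e ] μ ↑ʳ e ≡ f (i ↑ˡ n)
      -- The neighbour to compare with is the image of `i ↑ˡ n` under `g`.
      large i with proper⇒compatible n n {f = f} p i (τ ⟨$⟩ʳ i)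
      ... | inj₁ ≢f       = contradiction (trans (fix _) (cong f (g-↑ˡ i))) ≢f
      ... | inj₂ (_ , μ<) = large-colour (f (i ↑ˡ n)) μ<
      h : Fin n → Fin d
      h i = proj₁ (large i)
      h-spec : ∀ i → μ ↑ʳ h i ≡ f (i ↑ˡ n)
      h-spec i = proj₂ (large i)
      h-fixed : Fixes στ h
      h-fixed i = Fin.↑ʳ-injective μ _ _ (begin
        μ ↑ʳ h i               ≡⟨ h-spec i ⟩
        f (i ↑ˡ n)             ≡⟨ trans (fix _) (cong f (g-↑ˡ i)) ⟩
        f (n ↑ʳ (τ ⟨$⟩ʳ i))    ≡⟨ trans (fix _) (cong f (g-↑ʳ (τ ⟨$⟩ʳ i))) ⟩
        f (στ i ↑ˡ n)          ≡⟨ h-spec (στ i) ⟨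
        μ ↑ʳ h (στ i)          ∎)

    extend-cong : ∀ h h′ → h ≗ h′ → extend h ≗ extend h′
    extend-cong h h′ e = +-elim {n} {n} _
      (λ i → trans (extend-↑ˡ h i) (trans (cong (μ ↑ʳ_) (e i)) (sym (extend-↑ˡ h′ i))))
      (λ i → trans (extend-↑ʳ h i) (trans (cong (μ ↑ʳ_) (e _)) (sym (extend-↑ʳ h′ i))))

    extend-injective : ∀ h h′ → extend h ≗ extend h′ → h ≗ h′
    extend-injective h h′ e i = Fin.↑ʳ-injective μ _ _
      (trans (sym (extend-↑ˡ h i)) (trans (e _) (extend-↑ˡ h′ i)))

    fixes-resp : ∀ {k l} (π : Fin k → Fin k) {f f′ : Fin k → Fin l} → f ≗ f′ → Fixes π f → Fixes π f′
    fixes-resp π e fix i = trans (sym (e i)) (trans (fix i) (e (π i)))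

    Q? : ∀ (f : Fin (n + n) → Fin (μ + d)) → Dec (Proper (K n n) μ f × Fixes g f)
    Q? f = proper? (K n n) μ f ×-dec fixes? g f

    -- A restriction with large colours exists only for proper fixed `f`. As for `preservesParts≡∑`,
    -- counting preimages spares its definition elsewhere.
    extensions : ∀ f → ⟦ Q? f ⟧ ≡ ∑[ h ∈ functions n d ] ⟦ fixes? στ h ⟧ * ⟦ f ≗? extend h ⟧
    extensions f = ⟦⟧-elim (Q? f)
      (λ (p , fix) → let h , h-fixed , f≗ = restrict f p fix in sym (trans
        (∑-cong (functions n d) λ h′ → sym (⟦⟧-× (fixes? στ h′) (f ≗? extend h′)))
        (count-single (functionDecSetoid n d) (functions-enumerates n d)
          (λ h′ → fixes? στ h′ ×-dec f ≗? extend h′) h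
          (λ {h′} (_ , e) → extend-injective h′ h λ v → trans (sym (e v)) (f≗ v))
          (λ {h′} e → fixes-resp στ (λ i → sym (e i)) h-fixed ,
                 λ v → trans (f≗ v) (sym (extend-cong h′ h e v))))))
      λ ¬q → sym (trans
        (∑-cong (functions n d) λ h → trans (sym (⟦⟧-× (fixes? στ h) (f ≗? extend h)))
          (⟦⟧-no (fixes? στ h ×-dec f ≗? extend h) λ (fix , e) → ¬q
            (proper-resp-≗ (K n n) (λ v → sym (e v)) (extend-proper h) ,
             fixes-resp g (λ v → sym (e v)) (extend-fixed h fix))))
        (∑-zero (functions n d)))

  #fixed-swap : #fixed (K n n) (μ + d) μ (swapₚ n ∘ₚ (σ ⊕ τ) ⟨$⟩ʳ_) ≡
                ∑[ h ∈ functions n d ] ⟦ fixes? (τ ∘ₚ σ ⟨$⟩ʳ_) h ⟧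
  #fixed-swap = begin
    #fixed (K n n) (μ + d) μ g
      ≡⟨ ∑-cong fs (λ f → trans (sym (⟦⟧-× (proper? (K n n) μ f) (fixes? g f))) (extensions f)) ⟩
    ∑[ f ∈ fs ] ∑[ h ∈ functions n d ] ⟦ fixes? στ h ⟧ * ⟦ f ≗? extend h ⟧
      ≡⟨ ∑-swap fs (functions n d) _ ⟩
    ∑[ h ∈ functions n d ] ∑[ f ∈ fs ] ⟦ fixes? στ h ⟧ * ⟦ f ≗? extend h ⟧
      ≡⟨ ∑-cong (functions n d) (λ h → trans (∑-*ˡ fs ⟦ fixes? στ h ⟧ _)
           (trans (cong (⟦ fixes? στ h ⟧ *_) (once (functions-enumerates (n + n) (μ + d)) (extend h)))
                  (*-identityʳ _))) ⟩
    ∑[ h ∈ functions n d ] ⟦ fixes? στ h ⟧ ∎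
    where fs = functions (n + n) (μ + d)

-- For fixed `σ` the product `τ ∘ₚ σ` runs over all permutations, so the inner sum is the rising
-- factorial whatever `σ` is, and the outer sum contributes `n !`.
∑-#fixed-swap : ∀ n μ d →
  ∑[ σ ∈ permutations n ] ∑[ τ ∈ permutations n ] #fixed (K n n) (μ + d) μ (swapₚ n ∘ₚ (σ ⊕ τ) ⟨$⟩ʳ_)
  ≡ n ! * (n ! * ((n + d ∸ 1) C n))
∑-#fixed-swap n μ d = begin
  ∑[ σ ∈ permutations n ] ∑[ τ ∈ permutations n ] #fixed (K n n) (μ + d) μ (swapₚ n ∘ₚ (σ ⊕ τ) ⟨$⟩ʳ_)
    ≡⟨ ∑-cong (permutations n) (λ σ → trans
         (∑-cong (permutations n) λ τ → #fixed-swap μ d σ τ)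
         (∑-reindex (permutationDecSetoid n) (permutationDecSetoid n)
           (permutations-enumerates n) (permutations-enumerates n)
           (_∘ₚ σ) (_∘ₚ Perm.flip σ) (λ τ → N (τ ∘ₚ σ)) N
           (λ e i → sym (trans (cong (σ ⟨$⟩ˡ_) (e i)) (inverseˡ σ)))
           (λ e i → sym (trans (cong (σ ⟨$⟩ʳ_) (e i)) (inverseʳ σ)))
           (λ {τ} {π} e → N-cong {τ ∘ₚ σ} {π} (λ i → sym (e i))))) ⟩
  ∑[ σ ∈ permutations n ] ∑ (permutations n) N
    ≡⟨ trans (∑-cong (permutations n) λ σ → trans (∑-fixes n d) (sym (*-identityˡ _)))
         (∑-*ʳ (permutations n) (rising d n) (const 1)) ⟩
  (∑[ σ ∈ permutations n ] 1) * rising d n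
    ≡⟨ cong₂ _*_ (∑-permutations-1 n) (rising≡!*C d n) ⟩
  n ! * (n ! * ((n + d ∸ 1) C n)) ∎
  where
  N : Permutation′ n → ℕ
  N π = ∑[ h ∈ functions n d ] ⟦ fixes? (π ⟨$⟩ʳ_) h ⟧
  N-cong : ∀ {π ρ} → π Perm.≈ ρ → N π ≡ N ρ
  N-cong {π} {ρ} e = ∑-cong (functions n d) λ h → ⟦⟧-cong (fixes? (π ⟨$⟩ʳ_) h) (fixes? (ρ ⟨$⟩ʳ_) h)
    (λ fix i → trans (fix i) (cong h (e i))) (λ fix i → trans (fix i) (cong h (sym (e i))))

-- Grouping permutations by their number of cycles

∑-upTo-suc : ∀ n (f : ℕ → ℕ) → ∑ (upTo (suc n)) f ≡ f 0 + (∑[ k ∈ upTo n ] f (suc k))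
∑-upTo-suc n f = cong (f 0 +_) (cong sum (begin
  map f (applyUpTo suc n)  ≡⟨ map-applyUpTo suc f n ⟩
  applyUpTo (f ∘ suc) n    ≡⟨ map-upTo (f ∘ suc) n ⟨
  map (f ∘ suc) (upTo n)   ∎))

∑-upTo-single : ∀ {n c} → c < n → (f : ℕ → ℕ) → ∑[ k ∈ upTo n ] ⟦ c ℕ.≟ k ⟧ * f k ≡ f c
∑-upTo-single {suc n} {zero} _ f = begin
  ∑[ k ∈ upTo (suc n) ] ⟦ 0 ℕ.≟ k ⟧ * f k ≡⟨ ∑-upTo-suc n (λ k → ⟦ 0 ℕ.≟ k ⟧ * f k) ⟩
  1 * f 0 + (∑[ k ∈ upTo n ] 0)           ≡⟨ cong₂ _+_ (*-identityˡ (f 0)) (∑-zero (upTo n)) ⟩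
  f 0 + 0                                 ≡⟨ +-identityʳ (f 0) ⟩
  f 0                                     ∎
∑-upTo-single {suc n} {suc c} (s≤s c<n) f = begin
  ∑[ k ∈ upTo (suc n) ] ⟦ suc c ℕ.≟ k ⟧ * f k
    ≡⟨ ∑-upTo-suc n (λ k → ⟦ suc c ℕ.≟ k ⟧ * f k) ⟩
  ∑[ k ∈ upTo n ] ⟦ suc c ℕ.≟ suc k ⟧ * f (suc k)
    ≡⟨ ∑-cong (upTo n) (λ k → ⟦⟧*-cong (suc c ℕ.≟ suc k) (c ℕ.≟ k) ℕ.suc-injective (cong suc) (λ _ → refl)) ⟩
  ∑[ k ∈ upTo n ] ⟦ c ℕ.≟ k ⟧ * f (suc k)
    ≡⟨ ∑-upTo-single c<n (f ∘ suc) ⟩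
  f (suc c) ∎

∑-grouped : ∀ (xs : List A) (h : A → ℕ) n → (∀ x → h x ≤ n) → (f : ℕ → ℕ) →
            ∑[ x ∈ xs ] f (h x) ≡ ∑[ k ≤ n ] length (filter (λ x → h x ℕ.≟ k) xs) * f k
∑-grouped xs h n h≤n f = begin
  ∑[ x ∈ xs ] f (h x)
    ≡⟨ ∑-cong xs (λ x → ∑-upTo-single (s≤s (h≤n x)) f) ⟨
  ∑[ x ∈ xs ] ∑[ k ∈ upTo (suc n) ] ⟦ h x ℕ.≟ k ⟧ * f k
    ≡⟨ ∑-swap xs (upTo (suc n)) _ ⟩
  ∑[ k ∈ upTo (suc n) ] ∑[ x ∈ xs ] ⟦ h x ℕ.≟ k ⟧ * f k
    ≡⟨ ∑-cong (upTo (suc n)) (λ k → trans (∑-*ʳ xs (f k) _)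
         (cong (_* f k) (sym (length-filter≡∑ (λ x → h x ℕ.≟ k) xs)))) ⟩
  ∑[ k ∈ upTo (suc n) ] length (filter (λ x → h x ℕ.≟ k) xs) * f k
    ≡⟨ ∑≤-upTo n _ ⟨
  ∑[ k ≤ n ] length (filter (λ x → h x ℕ.≟ k) xs) * f k ∎

∑≤-cong : ∀ n {f g : ℕ → ℕ} → f ≗ g → ∑≤ n f ≡ ∑≤ n g
∑≤-cong n f≗g = trans (∑≤-upTo n _) (trans (∑-cong (upTo (suc n)) f≗g) (sym (∑≤-upTo n _)))

∑≤-*ˡ : ∀ n c (f : ℕ → ℕ) → c * ∑≤ n f ≡ ∑[ k ≤ n ] c * f k
∑≤-*ˡ n c f = trans (cong (c *_) (∑≤-upTo n f)) (trans (sym (∑-*ˡ (upTo (suc n)) c f)) (sym (∑≤-upTo n _)))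

-- The filter defining `stirling₁ n k` is the fibre of `#cycles` over `k`.
∑-#cycles : ∀ n (f : ℕ → ℕ) → ∑[ π ∈ permutations n ] f (#cycles π) ≡ ∑[ k ≤ n ] stirling₁ n k * f k
∑-#cycles n = ∑-grouped (permutations n) #cycles n Cycles.size≤n

∑-#fixed-⊕ : ∀ m n Λ μ →
  ∑[ σ ∈ permutations m ] ∑[ τ ∈ permutations n ] #fixed (K m n) Λ μ (σ ⊕ τ ⟨$⟩ʳ_) ≡
  ∑[ k ≤ m ] ∑[ l ≤ n ] stirling₁ m k * stirling₁ n l * #proper (K k l) Λ μ
∑-#fixed-⊕ m n Λ μ = begin
  ∑[ σ ∈ permutations m ] ∑[ τ ∈ permutations n ] #fixed (K m n) Λ μ (σ ⊕ τ ⟨$⟩ʳ_)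
    ≡⟨ ∑-cong (permutations m) (λ σ → trans
         (∑-cong (permutations n) λ τ → #fixed-⊕ Λ μ σ τ)
         (∑-#cycles n (λ l → #proper (K (#cycles σ) l) Λ μ))) ⟩
  ∑[ σ ∈ permutations m ] ∑[ l ≤ n ] stirling₁ n l * #proper (K (#cycles σ) l) Λ μ
    ≡⟨ ∑-#cycles m (λ k → ∑[ l ≤ n ] stirling₁ n l * #proper (K k l) Λ μ) ⟩
  ∑[ k ≤ m ] stirling₁ m k * (∑[ l ≤ n ] stirling₁ n l * #proper (K k l) Λ μ)
    ≡⟨ ∑≤-cong m (λ k → trans (∑≤-*ˡ n (stirling₁ m k) (λ l → stirling₁ n l * #proper (K k l) Λ μ))
         (∑≤-cong n λ l → sym (*-assoc (stirling₁ m k) (stirling₁ n l) (#proper (K k l) Λ μ)))) ⟩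
  ∑[ k ≤ m ] ∑[ l ≤ n ] stirling₁ m k * stirling₁ n l * #proper (K k l) Λ μ ∎

-- Colours used on one part

count-complement : {Q : Pred A 0ℓ} (Q? : Decidable Q) (xs : List A) →
                   (∑[ x ∈ xs ] ⟦ ¬? (Q? x) ⟧) + (∑[ x ∈ xs ] ⟦ Q? x ⟧) ≡ length xs
count-complement Q? xs = trans (sym (∑-+ xs _ _))
  (trans (∑-cong xs λ x → complement (Q? x)) (∑-one xs))
  where
  complement : (d : Dec X) → ⟦ ¬? d ⟧ + ⟦ d ⟧ ≡ 1
  complement (yes _) = refl
  complement (no _)  = refl

length-allFin : ∀ n → length (allFin n) ≡ n
length-allFin n = length-tabulate {n = n} (λ i → i)

count-< : ∀ {μ Λ} → μ ≤ Λ → ∑[ c ∈ allFin Λ ] ⟦ toℕ c ℕ.<? μ ⟧ ≡ μ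
count-< {Λ = Λ} z≤n = trans (∑-cong (allFin Λ) λ c → ⟦⟧-no (toℕ c ℕ.<? 0) λ ()) (∑-zero (allFin Λ))
count-< {suc μ} {suc Λ} (s≤s μ≤Λ) = trans (∑-allFin-suc Λ (λ c → ⟦ toℕ c ℕ.<? suc μ ⟧))
  (cong suc (trans (∑-cong (allFin Λ) λ c → ⟦⟧-cong (suc (toℕ c) ℕ.<? suc μ) (toℕ c ℕ.<? μ) ℕ.≤-pred s≤s)
                   (count-< μ≤Λ)))

count-∀ : ∀ l Λ {Q : Pred (Fin Λ) 0ℓ} (Q? : Decidable Q) →
          ∑[ b ∈ functions l Λ ] ⟦ all? (Q? ∘ b) ⟧ ≡ (∑[ c ∈ allFin Λ ] ⟦ Q? c ⟧) ^ l
count-∀ zero    Λ Q? = refl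
count-∀ (suc l) Λ {Q} Q? = begin
  ∑[ b ∈ functions (suc l) Λ ] ⟦ all? (Q? ∘ b) ⟧
    ≡⟨ ∑-functions-suc l Λ _ (λ {f} {g} f≗g → ⟦⟧-cong (all? (Q? ∘ f)) (all? (Q? ∘ g))
         (λ q j → subst Q (f≗g j) (q j)) (λ q j → subst Q (sym (f≗g j)) (q j))) ⟩
  ∑[ c ∈ allFin Λ ] ∑[ b ∈ functions l Λ ] ⟦ all? (Q? ∘ (c Vector.∷ b)) ⟧
    ≡⟨ ∑-cong (allFin Λ) (λ c → trans
         (∑-cong (functions l Λ) λ b → trans
           (⟦⟧-cong (all? (Q? ∘ (c Vector.∷ b))) (Q? c ×-dec all? (Q? ∘ b))
             (λ q → q zero , λ j → q (suc j)) (λ (qc , qb) → λ { zero → qc ; (suc j) → qb j }))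
           (⟦⟧-× (Q? c) (all? (Q? ∘ b))))
         (trans (∑-*ˡ (functions l Λ) ⟦ Q? c ⟧ _) (cong (⟦ Q? c ⟧ *_) (count-∀ l Λ Q?)))) ⟩
  ∑[ c ∈ allFin Λ ] ⟦ Q? c ⟧ * (∑[ c ∈ allFin Λ ] ⟦ Q? c ⟧) ^ l
    ≡⟨ ∑-*ʳ (allFin Λ) _ _ ⟩
  (∑[ c ∈ allFin Λ ] ⟦ Q? c ⟧) ^ suc l ∎

module _ {Λ : ℕ} (μ : ℕ) where

  -- The colours 1, ..., μ are the elements with `toℕ c < μ`, as `toℕ` numbers from 0. Large colours
  -- are left out because they never constrain the other part.
  Used New : (Fin k → Fin Λ) → Pred (Fin Λ) 0ℓ
  Used a c = toℕ c < μ × ∃[ x ] a x ≡ c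
  New  a c = toℕ c < μ × ¬ (∃[ x ] a x ≡ c)

  used? : (a : Fin k → Fin Λ) → Decidable (Used a)
  used? a c = toℕ c ℕ.<? μ ×-dec any? λ x → a x Fin.≟ c

  new? : (a : Fin k → Fin Λ) → Decidable (New a)
  new? a c = toℕ c ℕ.<? μ ×-dec ¬? (any? λ x → a x Fin.≟ c)

  #used : (Fin k → Fin Λ) → ℕ
  #used a = ∑[ c ∈ allFin Λ ] ⟦ used? a c ⟧

  #used-cong : {a a′ : Fin k → Fin Λ} → a ≗ a′ → #used a ≡ #used a′
  #used-cong {a = a} {a′} a≗a′ = ∑-cong (allFin Λ) λ c → ⟦⟧-cong (used? a c) (used? a′ c)
    (λ (c<μ , x , e) → c<μ , x , trans (sym (a≗a′ x)) e)
    (λ (c<μ , x , e) → c<μ , x , trans (a≗a′ x) e)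

  -- The two sets of used colours can differ only in `c`, which is gained exactly when it is small
  -- and does not yet occur.
  #used-∷ : (c : Fin Λ) (a : Fin k → Fin Λ) → #used (c Vector.∷ a) ≡ #used a + ⟦ new? a c ⟧
  #used-∷ c a = begin
    ∑[ c′ ∈ allFin Λ ] ⟦ used? (c Vector.∷ a) c′ ⟧
      ≡⟨ ∑-cong (allFin Λ) (λ c′ → split c′ (used? (c Vector.∷ a) c′) (used? a c′) (c′ Fin.≟ c) (new? a c)) ⟩
    ∑[ c′ ∈ allFin Λ ] ⟦ used? a c′ ⟧ + ⟦ c′ Fin.≟ c ⟧ * ⟦ new? a c ⟧
      ≡⟨ ∑-+ (allFin Λ) _ _ ⟩
    #used a + (∑[ c′ ∈ allFin Λ ] ⟦ c′ Fin.≟ c ⟧ * ⟦ new? a c ⟧)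
      ≡⟨ cong (#used a +_) (trans (∑-*ʳ (allFin Λ) ⟦ new? a c ⟧ _)
           (trans (cong (_* ⟦ new? a c ⟧) (once (allFin-enumerates Λ) c)) (*-identityˡ _))) ⟩
    #used a + ⟦ new? a c ⟧ ∎
    where
    split : ∀ c′ (u : Dec (Used (c Vector.∷ a) c′)) (v : Dec (Used a c′)) (e : Dec (c′ ≡ c)) (w : Dec (New a c)) →
            ⟦ u ⟧ ≡ ⟦ v ⟧ + ⟦ e ⟧ * ⟦ w ⟧
    split c′ _        (yes (_ , v)) (yes refl) (yes (_ , ¬v)) = contradiction v ¬v
    split c′ (yes _)  (yes _) (yes _) (no _)  = refl
    split c′ (yes _)  (yes _) (no _)  w       = refl
    split c′ (no ¬u)  (yes (c<μ , x , e)) _ _ = contradiction (c<μ , suc x , e) ¬u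
    split c′ (yes (c<μ , zero , e))  (no ¬v) (no c′≢c) w = contradiction (sym e) c′≢c
    split c′ (yes (c<μ , suc x , e)) (no ¬v) _ _ = contradiction (c<μ , x , e) ¬v
    split c′ (yes _)  (no _) (yes _) (yes _) = refl
    split c′ (yes (c<μ , _)) (no ¬v) (yes refl) (no ¬w) =
      contradiction (c<μ , λ (x , e) → ¬v (c<μ , x , e)) ¬w
    split c′ (no ¬u) (no _) (yes refl) (yes (c<μ , _)) = contradiction (c<μ , zero , refl) ¬u
    split c′ (no _) (no _) (yes _) (no _) = refl
    split c′ (no _) (no _) (no _) _ = refl

  module _ (μ≤Λ : μ ≤ Λ) (a : Fin k → Fin Λ) where

    #new+#used : (∑[ c ∈ allFin Λ ] ⟦ new? a c ⟧) + #used a ≡ μ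
    #new+#used = trans (sym (∑-+ (allFin Λ) _ _))
      (trans (∑-cong (allFin Λ) λ c → split (toℕ c ℕ.<? μ) (any? λ x → a x Fin.≟ c)) (count-< μ≤Λ))
      where
      split : (d : Dec X) (e : Dec Y) → ⟦ d ×-dec ¬? e ⟧ + ⟦ d ×-dec e ⟧ ≡ ⟦ d ⟧
      split (yes _) (yes _) = refl
      split (yes _) (no _)  = refl
      split (no _)  _       = refl

    #new : ∑[ c ∈ allFin Λ ] ⟦ new? a c ⟧ ≡ μ ∸ #used a
    #new = trans (sym (ℕ.m+n∸n≡m _ (#used a))) (cong (_∸ #used a) #new+#used)

    #¬new : ∑[ c ∈ allFin Λ ] ⟦ ¬? (new? a c) ⟧ ≡ (Λ ∸ μ) + #used a
    #¬new = ℕ.+-cancelʳ-≡ N _ _ (begin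
      (∑[ c ∈ allFin Λ ] ⟦ ¬? (new? a c) ⟧) + N  ≡⟨ count-complement (new? a) (allFin Λ) ⟩
      length (allFin Λ)                          ≡⟨ length-allFin Λ ⟩
      Λ                                          ≡⟨ ℕ.m∸n+n≡m μ≤Λ ⟨
      (Λ ∸ μ) + μ                                ≡⟨ cong ((Λ ∸ μ) +_) (trans (+-comm (#used a) N) #new+#used) ⟨
      (Λ ∸ μ) + (#used a + N)                    ≡⟨ +-assoc (Λ ∸ μ) (#used a) N ⟨
      (Λ ∸ μ) + #used a + N                      ∎)
      where N = ∑[ c ∈ allFin Λ ] ⟦ new? a c ⟧

  -- The weight is arbitrary because removing a vertex replaces it by its image under the transfer
  -- operator. The colourings of `K k l` correspond to the weight with value `(Λ ∸ u) ^ l` at `u`.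
  ∑-used : ∀ k → (ℕ → ℕ) → ℕ
  ∑-used k w = ∑[ a ∈ functions k Λ ] w (#used a)

  ∑-used-zero : ∀ w → ∑-used 0 w ≡ w 0
  ∑-used-zero w = trans (+-identityʳ _) (cong w (trans
    (∑-cong (allFin Λ) λ c → ⟦⟧-no (used? (finToFun {Λ} {0} zero) c) λ ()) (∑-zero (allFin Λ))))

-- With u of the μ small colours in use, a further vertex keeps u in u ways
-- and increases it in μ ∸ u ways, apart from the ways to use a large colour.

step : ℕ → (ℕ → ℕ) → ℕ → ℕ
step μ w u = u * w u + (μ ∸ u) * w (suc u)

∑-used-suc : ∀ {Λ μ} → μ ≤ Λ → ∀ k w → ∑-used {Λ} μ (suc k) w ≡ ∑-used {Λ} μ k (λ u → (Λ ∸ μ) * w u + step μ w u)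
∑-used-suc {Λ} {μ} μ≤Λ k w = begin
  ∑[ a ∈ functions (suc k) Λ ] w (#used μ a)
    ≡⟨ ∑-functions-suc k Λ (w ∘ #used μ) (cong w ∘ #used-cong μ) ⟩
  ∑[ c ∈ allFin Λ ] ∑[ a ∈ functions k Λ ] w (#used μ (c Vector.∷ a))
    ≡⟨ ∑-swap (allFin Λ) (functions k Λ) _ ⟩
  ∑[ a ∈ functions k Λ ] ∑[ c ∈ allFin Λ ] w (#used μ (c Vector.∷ a))
    ≡⟨ ∑-cong (functions k Λ) (λ a → begin
         ∑[ c ∈ allFin Λ ] w (#used μ (c Vector.∷ a))
           ≡⟨ ∑-cong (allFin Λ) (λ c → trans (cong w (#used-∷ μ c a)) (split (#used μ a) (new? μ a c))) ⟩
         ∑[ c ∈ allFin Λ ] ⟦ ¬? (new? μ a c) ⟧ * w (#used μ a) + ⟦ new? μ a c ⟧ * w (suc (#used μ a))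
           ≡⟨ trans (∑-+ (allFin Λ) _ _) (cong₂ _+_ (∑-*ʳ (allFin Λ) _ _) (∑-*ʳ (allFin Λ) _ _)) ⟩
         (∑[ c ∈ allFin Λ ] ⟦ ¬? (new? μ a c) ⟧) * w (#used μ a) +
         (∑[ c ∈ allFin Λ ] ⟦ new? μ a c ⟧) * w (suc (#used μ a))
           ≡⟨ cong₂ (λ x y → x * w (#used μ a) + y * w (suc (#used μ a)))
                (#¬new μ μ≤Λ a) (#new μ μ≤Λ a) ⟩
         ((Λ ∸ μ) + #used μ a) * w (#used μ a) + (μ ∸ #used μ a) * w (suc (#used μ a))
           ≡⟨ rearrange (Λ ∸ μ) (#used μ a) (w (#used μ a)) _ ⟩
         (Λ ∸ μ) * w (#used μ a) + step μ w (#used μ a) ∎) ⟩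
  ∑[ a ∈ functions k Λ ] (Λ ∸ μ) * w (#used μ a) + step μ w (#used μ a) ∎
  where
  split : ∀ u (d : Dec X) → w (u + ⟦ d ⟧) ≡ ⟦ ¬? d ⟧ * w u + ⟦ d ⟧ * w (suc u)
  split u (yes _) = trans (cong w (+-comm u 1)) (sym (+-identityʳ (w (suc u))))
  split u (no _)  = trans (cong w (+-identityʳ u)) (sym (trans (+-identityʳ _) (+-identityʳ _)))
  rearrange : ∀ d u x y → (d + u) * x + y ≡ d * x + (u * x + y)
  rearrange = solve-∀

-- Given the colours `a` of the first part, the vertices of the second choose independently, each
-- avoiding only the small colours in use.
#proper≡∑-used : ∀ {Λ} μ k l → #proper (K k l) Λ μ ≡ ∑-used {Λ} μ k (λ u → (Λ ∸ u) ^ l)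
#proper≡∑-used {Λ} μ k l = begin
  #proper (K k l) Λ μ
    ≡⟨ #proper≡∑ (K k l) Λ μ ⟩
  ∑[ f ∈ functions (k + l) Λ ] ⟦ proper? (K k l) μ f ⟧
    ≡⟨ ∑-functions-+ k l Λ _ (λ {f} {g} f≗g → ⟦⟧-cong (proper? (K k l) μ f) (proper? (K k l) μ g)
         (proper-resp-≗ (K k l) f≗g) (proper-resp-≗ (K k l) (λ v → sym (f≗g v)))) ⟩
  ∑[ a ∈ functions k Λ ] ∑[ b ∈ functions l Λ ] ⟦ proper? (K k l) μ (a Vector.++ b) ⟧
    ≡⟨ ∑-cong (functions k Λ) (λ a → begin
         ∑[ b ∈ functions l Λ ] ⟦ proper? (K k l) μ (a Vector.++ b) ⟧
           ≡⟨ ∑-cong (functions l Λ) (λ b → ⟦⟧-cong (proper? (K k l) μ (a Vector.++ b))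
                (all? λ j → ¬? (used? μ a (b j))) (unused a b) (unused⁻¹ a b)) ⟩
         ∑[ b ∈ functions l Λ ] ⟦ all? (λ j → ¬? (used? μ a (b j))) ⟧
           ≡⟨ count-∀ l Λ (¬? ∘ used? μ a) ⟩
         (∑[ c ∈ allFin Λ ] ⟦ ¬? (used? μ a c) ⟧) ^ l
           ≡⟨ cong (_^ l) (trans (sym (ℕ.m+n∸n≡m _ (#used μ a))) (cong (_∸ #used μ a)
                (trans (count-complement (used? μ a) (allFin Λ)) (length-allFin Λ)))) ⟩
         (Λ ∸ #used μ a) ^ l ∎) ⟩
  ∑[ a ∈ functions k Λ ] (Λ ∸ #used μ a) ^ l ∎
  where
  unused : ∀ (a : Fin k → Fin Λ) (b : Fin l → Fin Λ) → Proper (K k l) μ (a Vector.++ b) → ∀ j → ¬ Used μ a (b j)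
  unused a b p j (b<μ , x , ax≡bj) with proper⇒compatible k l {f = a Vector.++ b} p x j
  ... | inj₁ ≢f = ≢f (trans (Vector.lookup-++ˡ a b x) (trans ax≡bj (sym (Vector.lookup-++ʳ a b j))))
  ... | inj₂ (_ , μ<) = ℕ.<⇒≱ b<μ (ℕ.≤-pred
    (subst (λ c → μ < suc (toℕ c)) (trans (Vector.lookup-++ˡ a b x) ax≡bj) μ<))
  unused⁻¹ : ∀ (a : Fin k → Fin Λ) (b : Fin l → Fin Λ) → (∀ j → ¬ Used μ a (b j)) → Proper (K k l) μ (a Vector.++ b)
  unused⁻¹ a b ¬used = compatible⇒proper k l λ i j →
    subst (λ c → Compatible μ c ((a Vector.++ b) (k ↑ʳ j))) (sym (Vector.lookup-++ˡ a b i))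
      (subst (Compatible μ (a i)) (sym (Vector.lookup-++ʳ a b j)) (compatible i j (a i Fin.≟ b j)))
    where
    compatible : ∀ i j → Dec (a i ≡ b j) → Compatible μ (a i) (b j)
    compatible i j (no ai≢bj)  = inj₁ ai≢bj
    compatible i j (yes ai≡bj) = inj₂ (ai≡bj , s≤s (ℕ.≮⇒≥ λ ai<μ →
      ¬used j (subst (λ c → toℕ c < μ) ai≡bj ai<μ , i , ai≡bj)))

-- Expansion of the transfer operator

∑≤-+ : ∀ n (f g : ℕ → ℕ) → ∑[ i ≤ n ] (f i + g i) ≡ ∑≤ n f + ∑≤ n g
∑≤-+ n f g = trans (∑≤-upTo n _) (trans (∑-+ (upTo (suc n)) f g)
  (sym (cong₂ _+_ (∑≤-upTo n f) (∑≤-upTo n g))))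

∑≤-cong-≤ : ∀ n {f g : ℕ → ℕ} → (∀ {i} → i ≤ n → f i ≡ g i) → ∑≤ n f ≡ ∑≤ n g
∑≤-cong-≤ n f≡g = trans (∑≤-upTo n _)
  (trans (∑-cong-∈ (upTo (suc n)) (λ i∈ → f≡g (ℕ.≤-pred (∈-upTo⁻ i∈)))) (sym (∑≤-upTo n _)))

∑≤-shift : ∀ n (f : ℕ → ℕ) → ∑≤ n f + f (suc n) ≡ f 0 + ∑≤ n (f ∘ suc)
∑≤-shift zero    f = rearrange (f 0) (f 1)
  where
  rearrange : ∀ a b → a + 0 + b ≡ a + (b + 0)
  rearrange = solve-∀
∑≤-shift (suc n) f = trans (+-assoc (f 0) _ _) (cong (f 0 +_) (∑≤-shift n (f ∘ suc)))

-- The value at 0 of the i-th power, since no colour is in use before the first vertex.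
step^ : ℕ → ℕ → (ℕ → ℕ) → ℕ
step^ μ zero    w = w 0
step^ μ (suc i) w = step^ μ i (step μ w)

recStirling₂ : ℕ → ℕ → ℕ
recStirling₂ zero    zero    = 1
recStirling₂ zero    (suc j) = 0
recStirling₂ (suc i) zero    = 0
recStirling₂ (suc i) (suc j) = suc j * recStirling₂ i (suc j) + recStirling₂ i j

recStirling₂-> : ∀ {i j} → i < j → recStirling₂ i j ≡ 0
recStirling₂-> {zero}  {suc j} _         = refl
recStirling₂-> {suc i} {suc j} (s≤s i<j) = begin
  suc j * recStirling₂ i (suc j) + recStirling₂ i j
    ≡⟨ cong₂ (λ x y → suc j * x + y) (recStirling₂-> (ℕ.m<n⇒m<1+n i<j)) (recStirling₂-> i<j) ⟩
  suc j * 0 + 0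
    ≡⟨ trans (+-identityʳ _) (*-zeroʳ (suc j)) ⟩
  0 ∎

-- The guard in `_P_` is harmless: beyond `n` the leading factor of `_P′_` vanishes by truncated
-- subtraction. This gives a recurrence valid for all arguments.
nPk≡nP′k : ∀ n k → (n P k) ≡ (n P′ k)
nPk≡nP′k n k with k ≤ᵇ n in eq
... | true  = refl
... | false = sym (vanishes k (ℕ.≰⇒> λ k≤n → subst T eq (ℕ.≤⇒≤ᵇ k≤n)))
  where
  vanishes : ∀ k → n < k → (n P′ k) ≡ 0
  vanishes (suc k) (s≤s n≤k) = cong (_* (n P′ k)) (ℕ.m≤n⇒m∸n≡0 n≤k)

nP[1+k] : ∀ n k → (n P suc k) ≡ (n ∸ k) * (n P k)
nP[1+k] n k = trans (nPk≡nP′k n (suc k)) (cong ((n ∸ k) *_) (sym (nPk≡nP′k n k)))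

-- Applying the induction hypothesis to `step μ w` splits each term in two: one keeps `j` with
-- factor `j`, the other moves to `suc j`, where `μ ∸ j` extends the falling factorial. Collecting
-- by index gives the Stirling recurrence.
step^-expand : ∀ μ i w → step^ μ i w ≡ ∑[ j ≤ i ] recStirling₂ i j * (μ P j) * w j
step^-expand μ zero    w = sym (trans (+-identityʳ _) (*-identityˡ (w 0)))
step^-expand μ (suc i) w = begin
  step^ μ i (step μ w)
    ≡⟨ step^-expand μ i (step μ w) ⟩
  ∑[ j ≤ i ] S j * (μ P j) * step μ w j
    ≡⟨ ∑≤-cong i (λ j → distribute (S j) (μ P j) j (w j) (μ ∸ j) (w (suc j))) ⟩
  ∑[ j ≤ i ] (h j + S j * ((μ ∸ j) * (μ P j)) * w (suc j))
    ≡⟨ ∑≤-+ i h h′ ⟩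
  ∑≤ i h + (∑[ j ≤ i ] S j * ((μ ∸ j) * (μ P j)) * w (suc j))
    ≡⟨ cong₂ _+_ h-shift (∑≤-cong i λ j → cong (λ x → S j * x * w (suc j)) (sym (nP[1+k] μ j))) ⟩
  ∑≤ i (h ∘ suc) + (∑[ j ≤ i ] S j * (μ P suc j) * w (suc j))
    ≡⟨ ∑≤-+ i (h ∘ suc) (λ j → S j * (μ P suc j) * w (suc j)) ⟨
  ∑[ j ≤ i ] (h (suc j) + S j * (μ P suc j) * w (suc j))
    -- The term at index 0 of the longer sum reduces to 0, since `recStirling₂ (suc i) 0` does.
    ≡⟨ ∑≤-cong i (λ j → collect (suc j) (S (suc j)) (S j) (μ P suc j) (w (suc j))) ⟩
  ∑[ j ≤ suc i ] recStirling₂ (suc i) j * (μ P j) * w j ∎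
  where
  S : ℕ → ℕ
  S = recStirling₂ i
  h : ℕ → ℕ
  h j = j * (S j * (μ P j) * w j)
  h′ : ℕ → ℕ
  h′ j = S j * ((μ ∸ j) * (μ P j)) * w (suc j)
  -- Both boundary terms vanish: `h 0` through its factor 0, and `h (suc i)` because there is no
  -- partition of `i` points into `suc i` blocks.
  h-shift : ∑≤ i h ≡ ∑≤ i (h ∘ suc)
  h-shift = begin
    ∑≤ i h             ≡⟨ +-identityʳ _ ⟨
    ∑≤ i h + 0         ≡⟨ cong (∑≤ i h +_) (trans (cong (λ x → suc i * (x * (μ P suc i) * w (suc i))) (recStirling₂-> (ℕ.n<1+n i)))
                                                  (*-zeroʳ (suc i))) ⟨
    ∑≤ i h + h (suc i) ≡⟨ ∑≤-shift i h ⟩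
    ∑≤ i (h ∘ suc)     ∎
  distribute : ∀ s p j x m y → s * p * (j * x + m * y) ≡ j * (s * p * x) + s * (m * p) * y
  distribute = solve-∀
  collect : ∀ j s s′ p x → j * (s * p * x) + s′ * p * x ≡ (j * s + s′) * p * x
  collect = solve-∀

-- This is the binomial theorem for the k-th power of `(Λ ∸ μ)` times the identity plus `step μ`,
-- evaluated at 0; the scalar commutes with `step μ`. The induction step is Pascal's rule.
∑-used-expand : ∀ {Λ μ} → μ ≤ Λ → ∀ k w →
                ∑-used {Λ} μ k w ≡ ∑[ i ≤ k ] (k C i) * (Λ ∸ μ) ^ (k ∸ i) * step^ μ i w
∑-used-expand {Λ} {μ} μ≤Λ zero    w = trans (∑-used-zero {Λ} μ w) (sym (trans (+-identityʳ (1 * w 0)) (*-identityˡ (w 0))))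
∑-used-expand {Λ} {μ} μ≤Λ (suc k) w = begin
  ∑-used {Λ} μ (suc k) w
    ≡⟨ ∑-used-suc μ≤Λ k w ⟩
  ∑[ a ∈ functions k Λ ] d * w (#used μ a) + step μ w (#used μ a)
    ≡⟨ ∑-+ (functions k Λ) (λ a → d * w (#used μ a)) (step μ w ∘ #used μ) ⟩
  (∑[ a ∈ functions k Λ ] d * w (#used μ a)) + ∑-used {Λ} μ k (step μ w)
    ≡⟨ cong (_+ ∑-used {Λ} μ k (step μ w)) (∑-*ˡ (functions k Λ) d (w ∘ #used μ)) ⟩
  d * ∑-used {Λ} μ k w + ∑-used {Λ} μ k (step μ w)
    ≡⟨ cong₂ (λ x y → d * x + y) (∑-used-expand μ≤Λ k w) (∑-used-expand μ≤Λ k (step μ w)) ⟩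
  d * (∑[ i ≤ k ] (k C i) * d ^ (k ∸ i) * s i) + (∑[ i ≤ k ] (k C i) * d ^ (k ∸ i) * s (suc i))
    ≡⟨ cong (_+ (∑[ i ≤ k ] (k C i) * d ^ (k ∸ i) * s (suc i))) (begin
         d * (∑[ i ≤ k ] (k C i) * d ^ (k ∸ i) * s i)
           ≡⟨ ∑≤-*ˡ k d (λ i → (k C i) * d ^ (k ∸ i) * s i) ⟩
         ∑[ i ≤ k ] d * ((k C i) * d ^ (k ∸ i) * s i)
           -- Absorbing `d` into the power requires `i ≤ k`, as `suc k ∸ i` is `suc (k ∸ i)` only
           -- then.
           ≡⟨ ∑≤-cong-≤ k (λ {i} i≤k → trans (rearrange d (k C i) (d ^ (k ∸ i)) (s i))
                (cong (λ e → (k C i) * d ^ e * s i) (sym (ℕ.+-∸-assoc 1 i≤k)))) ⟩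
         ∑≤ k g
           ≡⟨ +-identityʳ _ ⟨
         ∑≤ k g + 0
           -- The term added to make the index shift possible is 0 because `k C suc k` is.
           ≡⟨ cong (λ x → ∑≤ k g + x * d ^ (suc k ∸ suc k) * s (suc k)) (k>n⇒nCk≡0 (ℕ.n<1+n k)) ⟨
         ∑≤ k g + g (suc k)
           ≡⟨ ∑≤-shift k g ⟩
         g 0 + ∑≤ k (g ∘ suc) ∎) ⟩
  g 0 + ∑≤ k (g ∘ suc) + (∑[ i ≤ k ] (k C i) * d ^ (k ∸ i) * s (suc i))
    ≡⟨ +-assoc (g 0) _ _ ⟩
  g 0 + (∑≤ k (g ∘ suc) + (∑[ i ≤ k ] (k C i) * d ^ (k ∸ i) * s (suc i)))
    ≡⟨ cong (g 0 +_) (trans (sym (∑≤-+ k (g ∘ suc) (λ i → (k C i) * d ^ (k ∸ i) * s (suc i)))) (∑≤-cong k λ i → trans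
         (collect (k C suc i) (k C i) (d ^ (k ∸ i)) (s (suc i)))
         (cong (λ x → x * d ^ (k ∸ i) * s (suc i)) (nCk+nC[k+1]≡[n+1]C[k+1] k i)))) ⟩
  ∑[ i ≤ suc k ] (suc k C i) * d ^ (suc k ∸ i) * s i ∎
  where
  d = Λ ∸ μ
  s : ℕ → ℕ
  s i = step^ μ i w
  g : ℕ → ℕ
  g i = (k C i) * d ^ (suc k ∸ i) * s i
  rearrange : ∀ d c p x → d * (c * p * x) ≡ c * (d * p) * x
  rearrange = solve-∀
  collect : ∀ c c′ p x → c * p * x + c′ * p * x ≡ (c′ + c) * p * x
  collect = solve-∀

-- Stirling numbers of the second kind

-- With `Λ = μ = j` every colour is small, so a function is surjective exactly when `j` colours are
-- used; the indicator of `j` is the weight to expand.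
#surjections : ∀ i j → ∑[ f ∈ functions i j ] ⟦ surjective? f ⟧ ≡ recStirling₂ i j * j !
#surjections i j = begin
  ∑[ f ∈ functions i j ] ⟦ surjective? f ⟧
    ≡⟨ ∑-cong (functions i j) (λ f → ⟦⟧-cong (surjective? f) (j ℕ.≟ #used j f) (to f) (from f)) ⟩
  ∑-used {j} j i (λ u → ⟦ j ℕ.≟ u ⟧)
    ≡⟨ pure-step i (λ u → ⟦ j ℕ.≟ u ⟧) ⟩
  step^ j i (λ u → ⟦ j ℕ.≟ u ⟧)
    ≡⟨ step^-expand j i (λ u → ⟦ j ℕ.≟ u ⟧) ⟩
  ∑[ u ≤ i ] recStirling₂ i u * (j P u) * ⟦ j ℕ.≟ u ⟧
    ≡⟨ ∑≤-cong i (λ u → *-comm (recStirling₂ i u * (j P u)) ⟦ j ℕ.≟ u ⟧) ⟩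
  ∑[ u ≤ i ] ⟦ j ℕ.≟ u ⟧ * (recStirling₂ i u * (j P u))
    ≡⟨ pick (j ℕ.≤? i) ⟩
  recStirling₂ i j * (j P j)
    ≡⟨ cong (recStirling₂ i j *_) (nPn≡n! j) ⟩
  recStirling₂ i j * j ! ∎
  where
  -- For `j > i` the index `j` lies outside the sum, but then the Stirling number is 0 as well.
  pick : Dec (j ≤ i) → ∑[ u ≤ i ] ⟦ j ℕ.≟ u ⟧ * (recStirling₂ i u * (j P u)) ≡ recStirling₂ i j * (j P j)
  pick (yes j≤i) = trans (∑≤-upTo i _) (∑-upTo-single (s≤s j≤i) (λ u → recStirling₂ i u * (j P u)))
  pick (no j≰i)  = trans
    (trans (∑≤-cong-≤ i λ {u} u≤i → cong (_* (recStirling₂ i u * (j P u)))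
      (⟦⟧-no (j ℕ.≟ u) λ j≡u → j≰i (subst (_≤ i) (sym j≡u) u≤i)))
      (trans (∑≤-upTo i (const 0)) (∑-zero (upTo (suc i)))))
    (cong (_* (j P j)) (sym (recStirling₂-> (ℕ.≰⇒> j≰i))))
  -- There are no large colours, so the scalar part of the transfer operator is `j ∸ j`, that is 0.
  pure-step : ∀ i w → ∑-used {j} j i w ≡ step^ j i w
  pure-step zero    w = ∑-used-zero {j} j w
  pure-step (suc i) w = trans (∑-used-suc ℕ.≤-refl i w) (trans
    (∑-cong (functions i j) λ a → cong (λ x → x * w (#used j a) + step j w (#used j a)) (ℕ.n∸n≡0 j))
    (pure-step i (step j w)))
  to : ∀ (f : Fin i → Fin j) → (∀ c → ∃[ x ] f x ≡ c) → j ≡ #used j f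
  to f surj = begin
    j                                                  ≡⟨ length-allFin j ⟨
    length (allFin j)                                  ≡⟨ ∑-one (allFin j) ⟨
    ∑[ c ∈ allFin j ] 1                                ≡⟨ ∑-cong (allFin j) (λ c → ⟦⟧-yes (used? j f c) (Fin.toℕ<n c , surj c)) ⟨
    #used j f                                          ∎
  from : ∀ (f : Fin i → Fin j) → j ≡ #used j f → ∀ c → ∃[ x ] f x ≡ c
  from f j≡ c = proj₂ (decidable-stable (used? j f c) λ ¬used →
    count-none (¬? ∘ used? j f) (allFin j) #unused≡0 (index c) (subst (λ c → ¬ Used j f c) (sym (lookup-index c)) ¬used))
    where
    index : Fin j → Fin (length (allFin j))
    index = cast (sym (length-allFin j))
    lookup-index : ∀ c → lookup (allFin j) (index c) ≡ c
    lookup-index c = lookup-tabulate (λ i → i) c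
    #unused≡0 : ∑[ c ∈ allFin j ] ⟦ ¬? (used? j f c) ⟧ ≡ 0
    #unused≡0 = ℕ.+-cancelʳ-≡ (#used j f) _ _
      (trans (count-complement (used? j f) (allFin j)) (trans (length-allFin j) j≡))

sameKernel-isEquivalence : IsEquivalence (SameKernel {n} {k})
sameKernel-isEquivalence = record
  { refl  = λ x y → (λ e → e) , (λ e → e)
  ; sym   = λ s x y → proj₂ (s x y) , proj₁ (s x y)
  ; trans = λ s t x y → proj₁ (t x y) ∘ proj₁ (s x y) , proj₂ (s x y) ∘ proj₂ (t x y)
  }

module _ {i j} (r : Fin i → Fin j) (r-surj : ∀ c → ∃[ x ] r x ≡ c) where
  private
    r⁻¹ : Fin j → Fin i
    r⁻¹ c = proj₁ (r-surj c)

    r-r⁻¹ : ∀ c → r (r⁻¹ c) ≡ c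
    r-r⁻¹ c = proj₂ (r-surj c)

  -- A surjection with the kernel of `r` factors through `r` by the permutation `f ∘ r⁻¹`, for a
  -- section `r⁻¹` of `r`; equality of kernels makes it invertible, and surjectivity of `r` makes it
  -- unique.
  relabellings : ∀ f → ⟦ surjective? f ×-dec sameKernel? r f ⟧ ≡
                       ∑[ π ∈ permutations j ] ⟦ f ≗? ((π ⟨$⟩ʳ_) ∘ r) ⟧
  relabellings f = ⟦⟧-elim (surjective? f ×-dec sameKernel? r f)
    (λ (f-surj , s) →
      let f⁻¹ : Fin j → Fin i
          f⁻¹ c = proj₁ (f-surj c)
          f-f⁻¹ : ∀ c → f (f⁻¹ c) ≡ c
          f-f⁻¹ c = proj₂ (f-surj c)
          π : Permutation′ j
          π = permutation (f ∘ r⁻¹) (r ∘ f⁻¹)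
            (λ c → trans (proj₁ (s _ _) (r-r⁻¹ (r (f⁻¹ c)))) (f-f⁻¹ c))
            (λ c → trans (proj₂ (s _ _) (f-f⁻¹ (f (r⁻¹ c)))) (r-r⁻¹ c))
      in sym (count-single (permutationDecSetoid j) (permutations-enumerates j)
           (λ ρ → f ≗? ((ρ ⟨$⟩ʳ_) ∘ r)) π
           (λ {ρ} e c → trans (cong (ρ ⟨$⟩ʳ_) (sym (r-r⁻¹ c))) (sym (e (r⁻¹ c))))
           (λ {ρ} e x → sym (trans (e (r x)) (proj₁ (s _ _) (r-r⁻¹ (r x)))))))
    λ ¬q → sym (trans
      (∑-cong (permutations j) λ π → ⟦⟧-no (f ≗? ((π ⟨$⟩ʳ_) ∘ r)) λ e → ¬q
        ((λ c → r⁻¹ (π ⟨$⟩ˡ c) , trans (e _) (trans (cong (π ⟨$⟩ʳ_) (r-r⁻¹ _)) (inverseʳ π))) ,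
         λ x y → (λ rx≡ry → trans (e x) (trans (cong (π ⟨$⟩ʳ_) rx≡ry) (sym (e y)))) ,
                 (λ fx≡fy → trans (sym (inverseˡ π)) (trans (cong (π ⟨$⟩ˡ_) (trans (sym (e x)) (trans fx≡fy (e y)))) (inverseˡ π)))))
      (∑-zero (permutations j)))

  #relabellings : ∑[ f ∈ functions i j ] ⟦ surjective? f ×-dec sameKernel? r f ⟧ ≡ j !
  #relabellings = begin
    ∑[ f ∈ functions i j ] ⟦ surjective? f ×-dec sameKernel? r f ⟧
      ≡⟨ ∑-cong (functions i j) relabellings ⟩
    ∑[ f ∈ functions i j ] ∑[ π ∈ permutations j ] ⟦ f ≗? ((π ⟨$⟩ʳ_) ∘ r) ⟧
      ≡⟨ ∑-swap (functions i j) (permutations j) _ ⟩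
    ∑[ π ∈ permutations j ] ∑[ f ∈ functions i j ] ⟦ f ≗? ((π ⟨$⟩ʳ_) ∘ r) ⟧
      ≡⟨ ∑-cong (permutations j) (λ π → once (functions-enumerates i j) ((π ⟨$⟩ʳ_) ∘ r)) ⟩
    ∑[ π ∈ permutations j ] 1
      ≡⟨ ∑-permutations-1 j ⟩
    j ! ∎

-- Every kernel class of surjections has `j !` elements, one for each relabelling of the blocks.
stirling₂-! : ∀ i j → stirling₂ i j * j ! ≡ ∑[ f ∈ functions i j ] ⟦ surjective? f ⟧
stirling₂-! i j = begin
  stirling₂ i j * j !
    ≡⟨ #classes-* sameKernel? sameKernel-isEquivalence surjections (const 1) (j !) (λ {r} r∈ → begin
         ∑[ f ∈ surjections ] ⟦ sameKernel? r f ⟧ * 1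
           ≡⟨ ∑-filter surjective? (functions i j) _ ⟩
         ∑[ f ∈ functions i j ] ⟦ surjective? f ⟧ * (⟦ sameKernel? r f ⟧ * 1)
           ≡⟨ ∑-cong (functions i j) (λ f → trans (cong (⟦ surjective? f ⟧ *_) (*-identityʳ _))
                (sym (⟦⟧-× (surjective? f) (sameKernel? r f)))) ⟩
         ∑[ f ∈ functions i j ] ⟦ surjective? f ×-dec sameKernel? r f ⟧
           ≡⟨ #relabellings r (All.lookup (All.deduplicate⁺ sameKernel?
                (All.all-filter surjective? (functions i j))) r∈) ⟩
         j ! ∎) ⟩
  ∑ surjections (const 1)
    ≡⟨ ∑-one surjections ⟩
  length surjections
    ≡⟨ length-filter≡∑ surjective? (functions i j) ⟩
  ∑[ f ∈ functions i j ] ⟦ surjective? f ⟧ ∎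
  where surjections = filter surjective? (functions i j)

stirling₂≡rec : ∀ i j → stirling₂ i j ≡ recStirling₂ i j
stirling₂≡rec i j = ℕ.*-cancelʳ-≡ _ _ (j !) {{j !≢0}} (trans (stirling₂-! i j) (#surjections i j))

#proper≡bipartiteFormula : ∀ {Λ μ} → μ ≤ Λ → ∀ k l → #proper (K k l) Λ μ ≡ bipartiteFormula k l Λ μ
#proper≡bipartiteFormula {Λ} {μ} μ≤Λ k l = begin
  #proper (K k l) Λ μ
    ≡⟨ #proper≡∑-used {Λ} μ k l ⟩
  ∑-used {Λ} μ k w
    ≡⟨ ∑-used-expand μ≤Λ k w ⟩
  ∑[ i ≤ k ] (k C i) * (Λ ∸ μ) ^ (k ∸ i) * step^ μ i w
    ≡⟨ ∑≤-cong k (λ i → cong ((k C i) * (Λ ∸ μ) ^ (k ∸ i) *_) (trans (step^-expand μ i w)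
         (∑≤-cong i λ j → trans (cong (λ s → s * (μ P j) * w j) (sym (stirling₂≡rec i j)))
           (rearrange (stirling₂ i j) (μ P j) (w j))))) ⟩
  bipartiteFormula k l Λ μ ∎
  where
  w : ℕ → ℕ
  w j = (Λ ∸ j) ^ l
  rearrange : ∀ a b c → a * b * c ≡ a * c * b
  rearrange = solve-∀

-- Counting orbits

#fixed-cong : ∀ Γ Λ μ {g h : Permutation′ (Graph.order Γ)} → g Perm.≈ h →
              #fixed Γ Λ μ (g ⟨$⟩ʳ_) ≡ #fixed Γ Λ μ (h ⟨$⟩ʳ_)
#fixed-cong Γ Λ μ {g} {h} g≈h = ∑-cong (functions (Graph.order Γ) Λ) λ f →
  cong (⟦ proper? Γ μ f ⟧ *_) (⟦⟧-cong (fixes? (g ⟨$⟩ʳ_) f) (fixes? (h ⟨$⟩ʳ_) f)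
    (λ fix v → trans (fix v) (cong f (g≈h v))) (λ fix v → trans (fix v) (cong f (sym (g≈h v)))))

∑-permutations²-1 : ∀ m n → ∑[ σ ∈ permutations m ] ∑[ τ ∈ permutations n ] 1 ≡ m ! * n !
∑-permutations²-1 m n = begin
  ∑[ σ ∈ permutations m ] ∑[ τ ∈ permutations n ] 1
    ≡⟨ ∑-cong (permutations m) (λ σ → trans (∑-permutations-1 n) (sym (*-identityˡ _))) ⟩
  ∑[ σ ∈ permutations m ] 1 * n !
    ≡⟨ ∑-*ʳ (permutations m) (n !) (const 1) ⟩
  (∑[ σ ∈ permutations m ] 1) * n !
    ≡⟨ cong (_* n !) (∑-permutations-1 m) ⟩
  m ! * n ! ∎

-- Brings the group order into the form of a sum over automorphisms, so that the decomposition used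
-- for fixed colourings also evaluates it.
∑-Aut-1 : ∀ Γ → ∑[ g ∈ permutations (Graph.order Γ) ] ⟦ isAutomorphism? Γ g ⟧ ≡
                ∑[ g ∈ permutations (Graph.order Γ) ] ⟦ isAutomorphism? Γ g ⟧ * 1
∑-Aut-1 Γ = ∑-cong (permutations (Graph.order Γ)) λ g → sym (*-identityʳ ⟦ isAutomorphism? Γ g ⟧)

#orbits-≢ : ∀ {m n} Λ μ → .{{NonZero m}} → m ≢ n →
  #orbits (K m n) (Aut (K m n)) Λ μ * (m ! * n !) ≡
  ∑[ k ≤ m ] ∑[ l ≤ n ] stirling₁ m k * stirling₁ n l * #proper (K k l) Λ μ
#orbits-≢ {m} {n} Λ μ m≢n = begin
  #orbits (K m n) (Aut (K m n)) Λ μ * (m ! * n !)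
    ≡⟨ cong (#orbits (K m n) (Aut (K m n)) Λ μ *_) (trans (∑-Aut-1 (K m n))
         (trans (∑-Aut-≢ m≢n (const 1) (λ _ → refl)) (∑-permutations²-1 m n))) ⟨
  #orbits (K m n) (Aut (K m n)) Λ μ * (∑[ g ∈ permutations (m + n) ] ⟦ isAutomorphism? (K m n) g ⟧)
    ≡⟨ burnside (K m n) (Aut (K m n)) Λ μ ⟩
  ∑[ g ∈ permutations (m + n) ] ⟦ isAutomorphism? (K m n) g ⟧ * #fixed (K m n) Λ μ (g ⟨$⟩ʳ_)
    ≡⟨ ∑-Aut-≢ m≢n (λ g → #fixed (K m n) Λ μ (g ⟨$⟩ʳ_)) (λ {g} {h} → #fixed-cong (K m n) Λ μ {g} {h}) ⟩
  ∑[ σ ∈ permutations m ] ∑[ τ ∈ permutations n ] #fixed (K m n) Λ μ (σ ⊕ τ ⟨$⟩ʳ_)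
    ≡⟨ ∑-#fixed-⊕ m n Λ μ ⟩
  ∑[ k ≤ m ] ∑[ l ≤ n ] stirling₁ m k * stirling₁ n l * #proper (K k l) Λ μ ∎

#orbits-≡ : ∀ {n} Λ {μ} → .{{NonZero n}} → μ ≤ Λ →
  #orbits (K n n) (Aut (K n n)) Λ μ * (2 * (n ! * n !)) ≡
  (∑[ k ≤ n ] ∑[ l ≤ n ] stirling₁ n k * stirling₁ n l * #proper (K k l) Λ μ)
    + n ! * n ! * ((n + Λ ∸ μ ∸ 1) C n)
-- Writing `Λ` as `μ + d` makes the large colours the image of `μ ↑ʳ_`.
#orbits-≡ {n} Λ {μ} μ≤Λ with d , refl ← ℕ.m≤n⇒∃[o]m+o≡n μ≤Λ = begin
  #orbits Kₙₙ (Aut Kₙₙ) Λ μ * (2 * (n ! * n !))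
    ≡⟨ cong (#orbits Kₙₙ (Aut Kₙₙ) Λ μ *_) (trans (∑-Aut-1 Kₙₙ)
         (trans (∑-Aut-≡ (const 1) (λ _ → refl)) (trans
           (cong₂ _+_ (∑-permutations²-1 n n) (∑-permutations²-1 n n)) (cong (n ! * n ! +_) (sym (+-identityʳ _)))))) ⟨
  #orbits Kₙₙ (Aut Kₙₙ) Λ μ * (∑[ g ∈ permutations (n + n) ] ⟦ isAutomorphism? Kₙₙ g ⟧)
    ≡⟨ burnside Kₙₙ (Aut Kₙₙ) Λ μ ⟩
  ∑[ g ∈ permutations (n + n) ] ⟦ isAutomorphism? Kₙₙ g ⟧ * #fixed Kₙₙ Λ μ (g ⟨$⟩ʳ_)
    ≡⟨ ∑-Aut-≡ (λ g → #fixed Kₙₙ Λ μ (g ⟨$⟩ʳ_)) (λ {g} {h} → #fixed-cong Kₙₙ Λ μ {g} {h}) ⟩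
  (∑[ σ ∈ permutations n ] ∑[ τ ∈ permutations n ] #fixed Kₙₙ Λ μ (σ ⊕ τ ⟨$⟩ʳ_)) +
  (∑[ σ ∈ permutations n ] ∑[ τ ∈ permutations n ] #fixed Kₙₙ Λ μ (swapₚ n ∘ₚ (σ ⊕ τ) ⟨$⟩ʳ_))
    ≡⟨ cong₂ _+_ (∑-#fixed-⊕ n n Λ μ) (begin
         ∑[ σ ∈ permutations n ] ∑[ τ ∈ permutations n ] #fixed Kₙₙ Λ μ (swapₚ n ∘ₚ (σ ⊕ τ) ⟨$⟩ʳ_)
           ≡⟨ ∑-#fixed-swap n μ d ⟩
         n ! * (n ! * ((n + d ∸ 1) C n))
           ≡⟨ *-assoc (n !) (n !) _ ⟨
         n ! * n ! * ((n + d ∸ 1) C n)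
           ≡⟨ cong (λ x → n ! * n ! * ((x ∸ 1) C n))
                (trans (ℕ.+-∸-assoc n μ≤Λ) (cong (n +_) (ℕ.m+n∸m≡n μ d))) ⟨
         n ! * n ! * ((n + Λ ∸ μ ∸ 1) C n) ∎) ⟩
  (∑[ k ≤ n ] ∑[ l ≤ n ] stirling₁ n k * stirling₁ n l * #proper (K k l) Λ μ)
    + n ! * n ! * ((n + Λ ∸ μ ∸ 1) C n) ∎
  where
  Kₙₙ = K n n

-- Opened only here, as +_ makes the sections (n +_) of addition ambiguous.

open import Data.Integer.Base using (+_)

-- Passage from natural-number identities to rationals

toℚᵘ-1/* : ∀ D-1 x → toℚᵘ ((+ 1 / suc D-1) *ℚ fromℕ x) ℚᵘ.≃ mkℚᵘ (+ x) D-1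
toℚᵘ-1/* D-1 x = ℚᵘ.≃-trans (ℚ.toℚᵘ-homo-* (+ 1 / suc D-1) (fromℕ x)) (ℚᵘ.≃-trans
  (ℚᵘ.*-cong (ℚ.toℚᵘ-fromℚᵘ (mkℚᵘ (+ 1) D-1)) ℚᵘ.≃-refl)
  (*≡* (trans (cong (ℤ._* + suc D-1) (ℤ.*-identityˡ (+ x))) (cong (λ D → + x ℤ.* + D) (sym (*-identityʳ (suc D-1)))))))

-- Among unnormalised rationals equality is cross multiplication, so the claim becomes an integer
-- identity without common divisors.
fromℕ-÷ : ∀ {N D x} .{{_ : NonZero D}} → N * D ≡ x → fromℕ N ≡ (+ 1 / D) *ℚ fromℕ x
fromℕ-÷ {N} {suc D-1} {x} eq = ℚ.toℚᵘ-injective (ℚᵘ.≃-sym (ℚᵘ.≃-trans (toℚᵘ-1/* D-1 x) (*≡* (begin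
  + x ℤ.* + 1         ≡⟨ ℤ.*-identityʳ (+ x) ⟩
  + x                 ≡⟨ cong +_ eq ⟨
  + (N * suc D-1)     ≡⟨ ℤ.pos-* N (suc D-1) ⟩
  + N ℤ.* + suc D-1   ∎))))

fromℕ-÷-+½ : ∀ {N E x y} .{{_ : NonZero (2 * E)}} → N * (2 * E) ≡ x + E * y →
             fromℕ N ≡ ((+ 1 / (2 * E)) *ℚ fromℕ x) +ℚ (½ *ℚ fromℕ y)
fromℕ-÷-+½ {N} {E@(suc _)} {x} {y} eq = ℚ.toℚᵘ-injective (ℚᵘ.≃-sym (ℚᵘ.≃-trans
  (ℚ.toℚᵘ-homo-+ ((+ 1 / (2 * E)) *ℚ fromℕ x) (½ *ℚ fromℕ y)) (ℚᵘ.≃-trans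
  -- `mkℚᵘ` stores the denominator minus one, so the argument `1` stands for the denominator 2 of
  -- `½`.
  (ℚᵘ.+-cong (toℚᵘ-1/* _ x) (toℚᵘ-1/* 1 y)) (*≡* (begin
  (+ x ℤ.* + 2 ℤ.+ + y ℤ.* + (2 * E)) ℤ.* + 1
    ≡⟨ ℤ.*-identityʳ _ ⟩
  + x ℤ.* + 2 ℤ.+ + y ℤ.* + (2 * E)
    ≡⟨ cong₂ ℤ._+_ (ℤ.pos-* x 2) (ℤ.pos-* y (2 * E)) ⟨
  + (x * 2 + y * (2 * E))
    ≡⟨ cong +_ (double x y E) ⟩
  + ((x + E * y) * 2)
    ≡⟨ cong (λ z → + (z * 2)) eq ⟨
  + (N * (2 * E) * 2)
    ≡⟨ cong +_ (*-assoc N (2 * E) 2) ⟩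
  + (N * (2 * E * 2))
    ≡⟨ ℤ.pos-* N (2 * E * 2) ⟩
  + N ℤ.* + (2 * E * 2) ∎)))))
  where
  double : ∀ x y e → x * 2 + y * (2 * e) ≡ (x + e * y) * 2
  double = solve-∀

theorem7 : (m n Λ μ : ℕ) → .{{_ : NonZero m}} → .{{_ : NonZero n}} → .{{_ : NonZero Λ}} → μ ≤ Λ →
    (m ≢ n →
    fromℕ (#orbits (K m n) (Aut (K m n)) Λ μ)
    ≡ ((+ 1 / (m ! * n !)) {{m !* n !≢0}})
    *ℚ fromℕ (∑[ k ≤ m ] ∑[ l ≤ n ] stirling₁ m k * stirling₁ n l * #proper (K k l) Λ μ))
    × (fromℕ (#orbits (K n n) (Aut (K n n)) Λ μ)
    ≡ (((+ 1 / (2 * (n ! * n !))) {{m*n≢0 2 (n ! * n !) {{_}} {{n !* n !≢0}}}})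
    *ℚ fromℕ (∑[ k ≤ n ] ∑[ l ≤ n ] stirling₁ n k * stirling₁ n l * #proper (K k l) Λ μ))
    +ℚ (½ *ℚ fromℕ ((n + Λ ∸ μ ∸ 1) C n)))
    × ((k l : ℕ) → #proper (K k l) Λ μ ≡ bipartiteFormula k l Λ μ)
theorem7 m n Λ μ μ≤Λ =
  (λ m≢n → fromℕ-÷ {{m !* n !≢0}} (#orbits-≢ Λ μ m≢n)) ,
  fromℕ-÷-+½ {E = n ! * n !} {{m*n≢0 2 (n ! * n !) {{_}} {{n !* n !≢0}}}} (#orbits-≡ Λ μ≤Λ) ,
  #proper≡bipartiteFormula μ≤Λ
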